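{- Let $p\ge 3$ be a prime and let $a(m)=a_{1+x,p}(m)$ denote the number of accessible $m$-blocks for the polynomial $1+x$ modulo $p$. Then $a(0)=1$, $a(1)=p$, $a(2)=p^2$, and for all integers $n\ge 0$ and $0\le k\le p-1$ with $pn+k\ge 3$, $$a(pn+k)=\frac{(p-k)(p-k+1)}{2}\,a(n)+\Big(kp+k-k^2+\frac{p^2-p}{2}\Big)a(n+1)+\frac{k^2-k}{2}\,a(n+2)-(2p-1)(2p-2).$$
   Context: For a prime $p$ and a polynomial $f(x)$ with integer coefficients, "row $i$" is the string of coefficients of $f(x)^i$ reduced modulo $p$, ordered by increasing powers of $x$ (from $x^0$ up to $x^{\deg f^i}$). An $m$-block is a string of $m$ residues modulo $p$. An $m$-block is accessible if it occurs as a substring of consecutive entries of row $i$ for some $i\ge 0$. $a_{f,p}(m)$ is the number of accessible $m$-blocks, with the convention $a_{f,p}(0)=1$. -}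

module Defs where

open import Data.Nat using (ℕ; zero; suc; _+_; _*_; NonZero)
open import Data.Nat.DivMod using (_mod_)
open import Data.Fin using (Fin)
open import Data.List using (List; []; _∷_; _++_; map)
open import Data.Vec using (Vec; toList)
open import Data.Product using (Σ; ∃; _×_)
open import Data.List.Relation.Unary.Unique.Propositional using (Unique)
open import Data.List.Membership.Propositional using (_∈_)
open import Function.Bundles using (_⇔_)
open import Relation.Binary.PropositionalEquality using (_≡_)

-- Polynomials with natural-number coefficients, as coefficient lists
-- ordered by increasing powers of x.
polyAdd : List ℕ → List ℕ → List ℕ
polyAdd [] q = q
polyAdd (a ∷ as) [] = a ∷ as
polyAdd (a ∷ as) (b ∷ bs) = (a + b) ∷ polyAdd as bs

-- product of polynomials (for nonempty arguments, length = len f + len g - 1)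
polyMul : List ℕ → List ℕ → List ℕ
polyMul [] q = []
polyMul (a ∷ []) q = map (a *_) q
polyMul (a ∷ b ∷ as) q = polyAdd (map (a *_) q) (0 ∷ polyMul (b ∷ as) q)

polyPow : List ℕ → ℕ → List ℕ
polyPow f zero = 1 ∷ []
polyPow f (suc i) = polyMul f (polyPow f i)

onePlusX : List ℕ
onePlusX = 1 ∷ 1 ∷ []

row : (p : ℕ) .{{_ : NonZero p}} → List ℕ → ℕ → List (Fin p)
row p f i = map (λ c → c mod p) (polyPow f i)

Accessible : (p : ℕ) .{{_ : NonZero p}} → List ℕ → (m : ℕ) → Vec (Fin p) m → Set
Accessible p f m w =
  ∃ λ i → ∃ λ (u : List (Fin p)) → ∃ λ (v : List (Fin p)) →
    u ++ toList w ++ v ≡ row p f i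

IsNumAccessible : (p : ℕ) .{{_ : NonZero p}} → List ℕ → ℕ → ℕ → Set
IsNumAccessible p f m c =
  Σ (List (Vec (Fin p) m)) λ L →
    Unique L × (Data.List.length L ≡ c) × (∀ w → (w ∈ L) ⇔ Accessible p f m w)

{-# OPTIONS --safe #-}

-- Modulo p, row pn + j of Pascal's triangle is row n with every entry c replaced by the p entries
-- c C(j,0), …, c C(j,p-1) (Lucas). Hence the accessible m-blocks found in rows ≡ j at positions
-- ≡ r + 1 are in bijection with the accessible blocks of length about m / p, and summing the
-- lengths over the p² pairs (r, j) gives the main terms of the recurrence.
--
-- The constant corrects for blocks found at several pairs. Comparing coefficients in
-- (1 + x) f′ = N f for f = (1 + x)ᴺ, the entries of a block satisfy a recurrence whose coefficients
-- modulo p depend only on (r, j). A block of length at least 3 satisfying two of these is 0, c0…0,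
-- 0…0c or c,-c,c,-c,… with c ≠ 0. The zero block arises from all p² pairs and each of the 3(p-1)
-- others from exactly p of them, an excess of (p² - 1) + 3(p-1)² = (2p-1)(2p-2).
module Submission where

open import Data.Fin.Base as Fin using (Fin; toℕ; fromℕ<)
import Data.Fin.Properties as Fin
open import Data.Integer.Base using (ℤ; +_)
open import Data.Integer.DivMod using (n%ℕd<d; a≡a%ℕn+[a/ℕn]*n)
open import Data.Integer.Divisibility.Signed using (divides; ∣ᵤ⇒∣)
import Data.Integer.Properties as ℤ
open import Data.Integer.Tactic.RingSolver using (solve-∀)
open import Data.List.Base as List
  using (List; []; _∷_; _++_; length; map; filter; deduplicate; concatMap; allFin; tabulate;
         cartesianProduct; cartesianProductWith)
import Data.List.Membership.DecPropositional as DecMembership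
open import Data.List.Membership.Propositional using (_∈_; _∉_; lose)
open import Data.List.Membership.Propositional.Properties
open import Data.List.Membership.Propositional.Properties.WithK using (unique∧set⇒bag)
import Data.List.Properties as List
open import Data.List.Relation.Binary.BagAndSetEquality using (∼bag⇒↭)
open import Data.List.Relation.Binary.Permutation.Propositional.Properties using (↭-length)
open import Data.List.Relation.Unary.All as All using ([])
open import Data.List.Relation.Unary.AllPairs using ([]; _∷_)
open import Data.List.Relation.Unary.Any using (here; there; satisfied)
open import Data.List.Relation.Unary.Unique.DecPropositional.Properties using (deduplicate-!)
open import Data.List.Relation.Unary.Unique.Propositional using (Unique)
import Data.List.Relation.Unary.Unique.Propositional.Properties as Unique
open import Data.Nat.Base as ℕ using (ℕ; zero; suc; NonZero; z≤n; s≤s; z<s; s<s)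
open import Data.Nat.Coprimality using (prime⇒coprime; coprime-Bézout)
open import Data.Nat.DivMod using (_mod_)
import Data.Nat.DivMod as ℕ
import Data.Nat.Divisibility as ℕ
open import Data.Nat.GCD using (module Bézout)
open import Data.Nat.Induction using (<-rec)
open import Data.Nat.ListAction using (sum)
open import Data.Nat.ListAction.Properties using (sum-++)
open import Data.Nat.Primality using (Prime; euclidsLemma)
import Data.Nat.Properties as ℕ
open import Algebra.Properties.CommutativeSemigroup ℕ.+-commutativeSemigroup using (x∙yz≈y∙xz)
open import Data.Product.Base using (Σ; ∃; _×_; _,_; proj₁; proj₂)
open import Data.Sum.Base using (_⊎_; inj₁; inj₂; [_,_]′)
open import Data.Vec.Base using (Vec; []; _∷_; toList)
import Data.Vec.Properties as Vec
open import Defs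
open import Function.Base using (_∘_; id)
open import Function.Bundles using (_⇔_; mk⇔; Equivalence)
open import Function.Properties.Equivalence using () renaming (sym to ⇔-sym; trans to ⇔-trans)
open import Relation.Binary.Bundles using (Setoid)
open import Relation.Binary.Definitions using (DecidableEquality)
open import Relation.Binary.PropositionalEquality
import Relation.Binary.Reasoning.Setoid as SetoidReasoning
open import Relation.Nullary using (¬_; Dec; yes; no; contradiction)
open import Relation.Nullary.Decidable using (map′; ¬?)

-- Accessibility quantifies over all rows, so it is not evident that the accessible m-blocks can be
-- listed at all. The count is therefore constructed by strong recursion on m: from lists of the
-- accessible blocks of the p² parent lengths, all smaller than m once m ≥ 3, a list for m is
-- assembled, and the recurrence is read off from the way it was assembled. The obstacle to a clean
-- correspondence with parents is the boundary: a window may run past the end of its row or start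
-- too close to the beginning. Lucas's theorem for a large power of p removes it. Every window,
-- continued by zeros, reappears inside a far longer row with row number and position unchanged
-- modulo p, and can be multiplied there by any constant; the same device realises the exceptional
-- blocks for all c. Starting positions are written r + 1 rather than r so that the single condition
-- j ≤ r decides for every r whether the first period contributes; for r = p - 1 the window starts
-- exactly at the next period.

module Pascal where

  open import Data.Integer.Base using (0ℤ; 1ℤ; -1ℤ; _+_; _*_; _-_; -_; ∣_∣; _%ℕ_; _/ℕ_)

  -- Counting by enumeration

  Enumerates : ∀ {A : Set} → List A → (A → Set) → Set
  Enumerates L P = Unique L × (∀ w → w ∈ L ⇔ P w)

  length-cartesianProductWith : ∀ {A B C : Set} (f : A → B → C) xs ys →
    length (cartesianProductWith f xs ys) ≡ length xs ℕ.* length ys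
  length-cartesianProductWith f []       ys = refl
  length-cartesianProductWith f (x ∷ xs) ys = trans (List.length-++ (map (f x) ys))
    (cong₂ ℕ._+_ (List.length-map (f x) ys) (length-cartesianProductWith f xs ys))

  length-allFin : ∀ n → length (allFin n) ≡ n
  length-allFin n = List.length-tabulate id

  enumerates-length : ∀ {A : Set} {L L′ : List A} {P} → Enumerates L P → Enumerates L′ P →
    length L ≡ length L′
  enumerates-length (u , L⇔) (u′ , L′⇔) =
    ↭-length (∼bag⇒↭ (unique∧set⇒bag u u′ λ {w} → ⇔-trans (L⇔ w) (⇔-sym (L′⇔ w))))

  sum-const : ∀ {A : Set} (f : A → ℕ) k xs → (∀ {x} → x ∈ xs → f x ≡ k) →
    sum (map f xs) ≡ length xs ℕ.* k
  sum-const f k []       _ = refl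
  sum-const f k (x ∷ xs) e = cong₂ ℕ._+_ (e (here refl)) (sum-const f k xs (e ∘ there))

  double-count : ∀ {A B : Set} {R : A → B → Set} (R? : ∀ x y → Dec (R x y)) xs ys →
                 sum (map (λ x → length (filter (R? x) ys)) xs) ≡
                 sum (map (λ y → length (filter (λ x → R? x y) xs)) ys)
  double-count R? [] ys = sym (trans (sum-const _ 0 ys λ _ → refl) (ℕ.*-zeroʳ (length ys)))
  double-count R? (x ∷ xs) ys =
    trans (cong (length (filter (R? x) ys) ℕ.+_) (double-count R? xs ys)) (step ys)
    where
    column  = λ y → length (filter (λ x → R? x y) xs)
    columns = λ ys → sum (map column ys)
    step : ∀ ys →
      length (filter (R? x) ys) ℕ.+ columns ys
        ≡ sum (map (λ y → length (filter (λ x → R? x y) (x ∷ xs))) ys)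
    step [] = refl
    step (y ∷ ys) with R? x y
    ... | yes _ = cong suc (trans (x∙yz≈y∙xz (length (filter (R? x) ys)) (column y) (columns ys))
          (cong (column y ℕ.+_) (step ys)))
    ... | no  _ = trans (x∙yz≈y∙xz (length (filter (R? x) ys)) (column y) (columns ys))
          (cong (column y ℕ.+_) (step ys))

  module Cover {A I : Set} (_≟_ : DecidableEquality A)
               (indices : List I) (unique-indices : Unique indices) (complete : ∀ i → i ∈ indices)
               (pieces : I → List A) {P : I → A → Set}
               (enumerates : ∀ i → Enumerates (pieces i) (P i))
    where

    open DecMembership _≟_ using (_∈?_)

    multiplicity : A → ℕ
    multiplicity w = length (filter (λ i → w ∈? pieces i) indices)

    multiplicity≡ : ∀ {w K} → Enumerates K (λ i → P i w) → multiplicity w ≡ length K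
    multiplicity≡ {w} = enumerates-length
      ( Unique.filter⁺ (λ i → w ∈? pieces i) unique-indices
      , λ i → mk⇔ (λ i∈ → Equivalence.to (proj₂ (enumerates i) w)
        (proj₂ (∈-filter⁻ (λ i → w ∈? pieces i) {xs = indices} i∈)))
                  (λ Pi → ∈-filter⁺ (λ i → w ∈? pieces i) (complete i)
                    (Equivalence.from (proj₂ (enumerates i) w) Pi)))

    -- Both sides count incidences between indices and elements. Since `ys` contains every piece,
    -- each piece can be re-enumerated as a sublist of `ys`, and enumerations of one predicate have
    -- equal length.
    sum-pieces : ∀ {ys} → Unique ys → (∀ {i w} → P i w → w ∈ ys) →
                 sum (map (length ∘ pieces) indices) ≡ sum (map multiplicity ys)
    sum-pieces {ys} unique-ys covers = trans
      (cong sum (List.map-cong (λ i → enumerates-length (enumerates i) (restricted i)) indices))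
      (double-count (λ i w → w ∈? pieces i) indices ys)
      where
      restricted : ∀ i → Enumerates (filter (_∈? pieces i) ys) (P i)
      restricted i = Unique.filter⁺ (_∈? pieces i) unique-ys ,
        λ w → mk⇔ (λ w∈ → Equivalence.to (proj₂ (enumerates i) w)
          (proj₂ (∈-filter⁻ (_∈? pieces i) {xs = ys} w∈)))
                  (λ Piw → ∈-filter⁺ (_∈? pieces i) (covers Piw)
                    (Equivalence.from (proj₂ (enumerates i) w) Piw))

    module _ {Q : A → Set} (P⇒Q : ∀ {i w} → P i w → Q w) (Q⇒P : ∀ {w} → Q w → ∃ λ i → P i w)
             (special : List A) (unique-special : Unique special)
             (special-Q : ∀ {w} → w ∈ special → Q w)
             (separated : ∀ {i i′ w} → P i w → P i′ w → i ≡ i′ ⊎ w ∈ special)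
      where

      ordinary : List A
      ordinary = filter (λ w → ¬? (w ∈? special)) (deduplicate _≟_ (concatMap pieces indices))

      ∈-ordinary⁻ : ∀ {w} → w ∈ ordinary → ∃ (λ i → P i w) × w ∉ special
      ∈-ordinary⁻ {w} w∈
        with w∈pieces , w∉ ← ∈-filter⁻ (λ w → ¬? (w ∈? special))
          {xs = deduplicate _≟_ (concatMap pieces indices)} w∈
        with i , w∈i ← satisfied
          (∈-concatMap⁻ pieces {xs = indices} (∈-deduplicate⁻ _≟_ _ w∈pieces)) =
        (i , Equivalence.to (proj₂ (enumerates i) w) w∈i) , w∉

      ∈-ordinary⁺ : ∀ {i w} → P i w → w ∉ special → w ∈ ordinary
      ∈-ordinary⁺ {i} {w} Piw w∉ = ∈-filter⁺ (λ w → ¬? (w ∈? special))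
        (∈-deduplicate⁺ _≟_
          (∈-concatMap⁺ pieces (lose (complete i) (Equivalence.from (proj₂ (enumerates i) w) Piw))))
            w∉

      cover-enumerates : Enumerates (special ++ ordinary) Q
      cover-enumerates =
        Unique.++⁺ unique-special (Unique.filter⁺ _ (deduplicate-! _≟_ (concatMap pieces indices)))
          (λ (w∈s , w∈o) → proj₂ (∈-ordinary⁻ w∈o) w∈s) ,
        λ w → mk⇔ ([ special-Q , (λ w∈o → P⇒Q (proj₂ (proj₁ (∈-ordinary⁻ w∈o)))) ]′ ∘ ∈-++⁻ special)
          from
        where
        from : ∀ {w} → Q w → w ∈ special ++ ordinary
        from {w} Qw with w ∈? special
        ... | yes w∈s = ∈-++⁺ˡ w∈s
        ... | no  w∉s = ∈-++⁺ʳ special (∈-ordinary⁺ (proj₂ (Q⇒P Qw)) w∉s)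

      -- By `separated`, an element outside `special` lies in exactly one piece, so its multiplicity
      -- is 1. The multiplicities of the special elements stay in the formula, to be evaluated with
      -- `multiplicity≡`.
      cover-count : sum (map (length ∘ pieces) indices)
        ≡ sum (map multiplicity special) ℕ.+ length ordinary
      cover-count =
        trans (sum-pieces (proj₁ cover-enumerates)
          (λ Piw → Equivalence.from (proj₂ cover-enumerates _) (P⇒Q Piw)))
        (trans (cong sum (List.map-++ multiplicity special ordinary))
          (trans (sum-++ (map multiplicity special) _)
          (cong (sum (map multiplicity special) ℕ.+_)
            (trans (sum-const multiplicity 1 ordinary once) (ℕ.*-identityʳ _)))))
        where
        once : ∀ {w} → w ∈ ordinary → multiplicity w ≡ 1
        once {w} w∈o with (i , Piw) , w∉s ← ∈-ordinary⁻ w∈o = multiplicity≡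
          ([] ∷ [] , λ i′ → mk⇔ (λ { (here refl) → Piw })
                                (λ Pi′w → [ here , (λ w∈s → contradiction w∈s w∉s) ]′
                                  (separated Pi′w Piw)))

  -- Sums

  ∑ : ℕ → (ℕ → ℕ) → ℕ
  ∑ zero    f = 0
  ∑ (suc n) f = f 0 ℕ.+ ∑ n (f ∘ suc)

  ∑-cong : ∀ n {f g} → (∀ i → i ℕ.< n → f i ≡ g i) → ∑ n f ≡ ∑ n g
  ∑-cong zero    e = refl
  ∑-cong (suc n) e = cong₂ ℕ._+_ (e 0 z<s) (∑-cong n λ i i<n → e (suc i) (s<s i<n))

  ∑-const : ∀ n c → ∑ n (λ _ → c) ≡ n ℕ.* c
  ∑-const zero    c = refl
  ∑-const (suc n) c = cong (c ℕ.+_) (∑-const n c)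

  ∑-split : ∀ m n f → ∑ (m ℕ.+ n) f ≡ ∑ m f ℕ.+ ∑ n (f ∘ (m ℕ.+_))
  ∑-split zero    n f = refl
  ∑-split (suc m) n f = trans (cong (f 0 ℕ.+_) (∑-split m n (f ∘ suc))) (sym (ℕ.+-assoc (f 0) _ _))

  sum-allFin : ∀ {n} (f : Fin n → ℕ) g → (∀ i → f i ≡ g (toℕ i)) → sum (map f (allFin n)) ≡ ∑ n g
  sum-allFin f g e = trans (cong sum (List.map-tabulate id f)) (sum-tabulate f g e)
    where
    sum-tabulate : ∀ {n} (f : Fin n → ℕ) g → (∀ i → f i ≡ g (toℕ i)) → sum (tabulate f) ≡ ∑ n g
    sum-tabulate {zero}  f g e = refl
    sum-tabulate {suc n} f g e = cong₂ ℕ._+_ (e Fin.zero)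
      (sum-tabulate (f ∘ Fin.suc) (g ∘ suc) (e ∘ Fin.suc))

  sum-cartesianProduct : ∀ {A B : Set} (f : A × B → ℕ) xs ys →
    sum (map f (cartesianProduct xs ys)) ≡ sum (map (λ x → sum (map (λ y → f (x , y)) ys)) xs)
  sum-cartesianProduct f []       ys = refl
  sum-cartesianProduct f (x ∷ xs) ys = trans (cong sum (List.map-++ f (map (x ,_) ys) _))
    (trans (sum-++ (map f (map (x ,_) ys)) _)
      (cong₂ ℕ._+_ (cong sum (sym (List.map-∘ ys))) (sum-cartesianProduct f xs ys)))

  -- A step function, recursive in both arguments to run in step with `∑`: its sums peel off without
  -- any comparison of numbers.
  threshold : ℕ → ℕ → ℕ → ℕ → ℕ
  threshold zero    x y _       = y
  threshold (suc t) x y zero    = x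
  threshold (suc t) x y (suc i) = threshold t x y i

  threshold-below : ∀ {t i} x y → i ℕ.< t → threshold t x y i ≡ x
  threshold-below {suc t} {zero}  x y _         = refl
  threshold-below {suc t} {suc i} x y (s<s i<t) = threshold-below x y i<t

  threshold-above : ∀ {t i} x y → t ℕ.≤ i → threshold t x y i ≡ y
  threshold-above {zero}          x y _         = refl
  threshold-above {suc t} {suc i} x y (s≤s t≤i) = threshold-above x y t≤i

  ∑-threshold : ∀ {n t} x y → t ℕ.≤ n → ∑ n (threshold t x y) ≡ t ℕ.* x ℕ.+ (n ℕ.∸ t) ℕ.* y
  ∑-threshold {n}     {zero}  x y _         = ∑-const n y
  ∑-threshold {suc n} {suc t} x y (s≤s t≤n) = trans (cong (x ℕ.+_) (∑-threshold x y t≤n))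
    (sym (ℕ.+-assoc x _ _))

  pos-∸ : ∀ {m n} → n ℕ.≤ m → + (m ℕ.∸ n) ≡ + m - + n
  pos-∸ {m} {n} n≤m = trans (sym (ℤ.⊖-≥ n≤m)) (sym (ℤ.m-n≡m⊖n m n))

  -- An arithmetic series, doubled so that no halves appear. The offset s carries the induction on A
  -- and later serves the sum over the upper range of r; the bound s + A ≤ p makes every truncated
  -- difference genuine.
  twice-∑-linear : ∀ p x y A s → s ℕ.+ A ℕ.≤ p →
    + 2 * + ∑ A (λ i → suc (s ℕ.+ i) ℕ.* x ℕ.+ (p ℕ.∸ suc (s ℕ.+ i)) ℕ.* y) ≡
    + A * (+ 2 * + s + + A + 1ℤ) * + x + + A * (+ 2 * + p - + 2 * + s - + A - 1ℤ) * + y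
  twice-∑-linear p x y zero    s _ = refl
  twice-∑-linear p x y (suc A) s h = begin
    + 2 * (+ head + + tail)
      ≡⟨ cong (λ t → + 2 * (+ head + t))
        (cong +_ (∑-cong A λ i _ → cong (λ t → suc t ℕ.* x ℕ.+ (p ℕ.∸ suc t) ℕ.* y)
          (ℕ.+-suc s i))) ⟩
    + 2 * (+ head + + tail′)
      ≡⟨ ℤ.*-distribˡ-+ (+ 2) (+ head) (+ tail′) ⟩
    + 2 * + head + + 2 * + tail′
      ≡⟨ cong₂ _+_ (cong (λ t → + 2 * t) head≡) (twice-∑-linear p x y A (suc s) h′) ⟩
    + 2 * ((1ℤ + + s) * + x + (+ p - (1ℤ + + s)) * + y) +
      (+ A * (+ 2 * (1ℤ + + s) + + A + 1ℤ) * + x + + A * (+ 2 * + p - + 2 * (1ℤ + + s) - + A - 1ℤ)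
        * + y)
      ≡⟨ identity (+ p) (+ s) (+ A) (+ x) (+ y) ⟩
    (1ℤ + + A) * (+ 2 * + s + (1ℤ + + A) + 1ℤ) * + x + (1ℤ + + A)
      * (+ 2 * + p - + 2 * + s - (1ℤ + + A) - 1ℤ) * + y ∎
    where
    open ≡-Reasoning
    head = suc (s ℕ.+ 0) ℕ.* x ℕ.+ (p ℕ.∸ suc (s ℕ.+ 0)) ℕ.* y
    tail = ∑ A (λ i → suc (s ℕ.+ suc i) ℕ.* x ℕ.+ (p ℕ.∸ suc (s ℕ.+ suc i)) ℕ.* y)
    tail′ = ∑ A (λ i → suc (suc s ℕ.+ i) ℕ.* x ℕ.+ (p ℕ.∸ suc (suc s ℕ.+ i)) ℕ.* y)
    h′ : suc s ℕ.+ A ℕ.≤ p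
    h′ = subst (ℕ._≤ p) (ℕ.+-suc s A) h
    head≡ : + head ≡ (1ℤ + + s) * + x + (+ p - (1ℤ + + s)) * + y
    head≡ rewrite ℕ.+-identityʳ s = cong₂ _+_ (ℤ.pos-* (suc s) x)
      (trans (ℤ.pos-* (p ℕ.∸ suc s) y) (cong (_* + y) (pos-∸ (ℕ.≤-trans (ℕ.m≤m+n (suc s) A) h′))))
    identity : ∀ p s A x y →
      + 2 * ((1ℤ + s) * x + (p - (1ℤ + s)) * y) +
      (A * (+ 2 * (1ℤ + s) + A + 1ℤ) * x + A * (+ 2 * p - + 2 * (1ℤ + s) - A - 1ℤ) * y) ≡
      (1ℤ + A) * (+ 2 * s + (1ℤ + A) + 1ℤ) * x + (1ℤ + A) * (+ 2 * p - + 2 * s - (1ℤ + A) - 1ℤ) * y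
    identity = solve-∀

  isNumAccessible-unique : ∀ {p} .{{_ : NonZero p}} {f m c c′} →
    IsNumAccessible p f m c → IsNumAccessible p f m c′ → c ≡ c′
  isNumAccessible-unique (L , unique , len , L⇔) (L′ , unique′ , len′ , L′⇔) =
    trans (sym len) (trans (enumerates-length (unique , L⇔) (unique′ , L′⇔)) len′)

  -- Binomial coefficients

  -- Integer values make differences and signs available before any reduction modulo p.
  binom : ℕ → ℕ → ℤ
  binom _       zero    = 1ℤ
  binom zero    (suc _) = 0ℤ
  binom (suc n) (suc z) = binom n z + binom n (suc z)

  binom-above : ∀ {n z} → n ℕ.< z → binom n z ≡ 0ℤ
  binom-above {zero}  z<s       = refl
  binom-above {suc n} (s<s n<z) =
    cong₂ _+_ (binom-above n<z) (binom-above (ℕ.<-trans n<z (ℕ.n<1+n _)))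

  binom-diag : ∀ n → binom n n ≡ 1ℤ
  binom-diag zero    = refl
  binom-diag (suc n) = cong₂ _+_ (binom-diag n) (binom-above (ℕ.n<1+n n))

  binom-1 : ∀ n → binom n 1 ≡ + n
  binom-1 zero    = refl
  binom-1 (suc n) = cong (λ t → 1ℤ + t) (binom-1 n)

  -- The coefficient form of (1 + x) f′ = n f for f = (1 + x)ⁿ.
  binom-rec : ∀ n z → + suc z * binom n (suc z) + + z * binom n z ≡ + n * binom n z
  binom-rec zero    zero    = refl
  binom-rec zero    (suc z) = cong₂ _+_ (ℤ.*-zeroʳ (+ suc (suc z))) (ℤ.*-zeroʳ (+ suc z))
  binom-rec (suc n) zero    =
    trans (lemma (binom n 1)) (cong (λ t → t * 1ℤ) (cong (λ t → 1ℤ + t) (binom-1 n)))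
    where
    lemma : ∀ b → 1ℤ * (1ℤ + b) + 0ℤ * 1ℤ ≡ (1ℤ + b) * 1ℤ
    lemma = solve-∀
  binom-rec (suc n) (suc z) =
    trans (lemma₁ (binom n z) (binom n (suc z)) (binom n (suc (suc z))) (+ z))
      (trans (cong₂ (λ s t → s + t + (binom n z + binom n (suc z))) (binom-rec n (suc z))
        (binom-rec n z))
        (lemma₂ (binom n z) (binom n (suc z)) (+ n)))
    where
    lemma₁ : ∀ a b c z → (1ℤ + (1ℤ + z)) * (b + c) + (1ℤ + z) * (a + b)
           ≡ ((1ℤ + (1ℤ + z)) * c + (1ℤ + z) * b) + ((1ℤ + z) * b + z * a) + (a + b)
    lemma₁ = solve-∀
    lemma₂ : ∀ a b n → n * b + n * a + (a + b) ≡ (1ℤ + n) * (a + b)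
    lemma₂ = solve-∀

  -- Rows as coefficient sequences of powers of 1 + x

  coef : List ℕ → ℕ → ℤ
  coef []       _       = 0ℤ
  coef (a ∷ as) zero    = + a
  coef (a ∷ as) (suc z) = coef as z

  coef-polyAdd : ∀ f g z → coef (polyAdd f g) z ≡ coef f z + coef g z
  coef-polyAdd []       g        z       = sym (ℤ.+-identityˡ (coef g z))
  coef-polyAdd (a ∷ as) []       z       = sym (ℤ.+-identityʳ (coef (a ∷ as) z))
  coef-polyAdd (a ∷ as) (b ∷ bs) zero    = refl
  coef-polyAdd (a ∷ as) (b ∷ bs) (suc z) = coef-polyAdd as bs z

  polyMul-onePlusX : ∀ f → polyMul onePlusX f ≡ polyAdd f (0 ∷ f)
  polyMul-onePlusX f = cong (λ g → polyAdd g (0 ∷ g))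
    (trans (List.map-cong ℕ.*-identityˡ f) (List.map-id f))

  coef-polyPow : ∀ n z → coef (polyPow onePlusX n) z ≡ binom n z
  coef-polyPow zero    zero    = refl
  coef-polyPow zero    (suc z) = refl
  coef-polyPow (suc n) z rewrite polyMul-onePlusX (polyPow onePlusX n) =
    trans (coef-polyAdd f (0 ∷ f) z) (step z)
    where
    f = polyPow onePlusX n
    step : ∀ z → coef f z + coef (0 ∷ f) z ≡ binom (suc n) z
    step zero    = trans (ℤ.+-identityʳ (coef f 0)) (coef-polyPow n 0)
    step (suc z) = trans (ℤ.+-comm (coef f (suc z)) (coef f z))
      (cong₂ _+_ (coef-polyPow n z) (coef-polyPow n (suc z)))

  length-polyAdd-shift : ∀ a f → length (polyAdd f (a ∷ f)) ≡ suc (length f)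
  length-polyAdd-shift a []       = refl
  length-polyAdd-shift a (b ∷ bs) = cong suc (length-polyAdd-shift b bs)

  length-polyPow : ∀ n → length (polyPow onePlusX n) ≡ suc n
  length-polyPow zero = refl
  length-polyPow (suc n) rewrite polyMul-onePlusX (polyPow onePlusX n) =
    trans (length-polyAdd-shift 0 (polyPow onePlusX n)) (cong suc (length-polyPow n))

  -- Entries of the exceptional blocks

  atStart : ℤ → ℕ → ℤ
  atStart c zero    = c
  atStart c (suc _) = 0ℤ

  atEnd : ℕ → ℤ → ℕ → ℤ
  atEnd zero    c zero    = c
  atEnd zero    c (suc y) = 0ℤ
  atEnd (suc l) c zero    = 0ℤ
  atEnd (suc l) c (suc y) = atEnd l c y

  alternating : ℤ → ℕ → ℤ
  alternating c zero    = c
  alternating c (suc y) = - alternating c y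

  atEnd-last : ∀ l c → atEnd l c l ≡ c
  atEnd-last zero    c = refl
  atEnd-last (suc l) c = atEnd-last l c

  atEnd-before : ∀ {l y} c → y ℕ.< l → atEnd l c y ≡ 0ℤ
  atEnd-before {suc l} {zero}  c _         = refl
  atEnd-before {suc l} {suc y} c (s<s y<l) = atEnd-before c y<l

  alternating-shift : ∀ c x y → c * alternating 1ℤ (x ℕ.+ y) ≡ alternating (c * alternating 1ℤ x) y
  alternating-shift c x zero    = cong (λ z → c * alternating 1ℤ z) (ℕ.+-identityʳ x)
  alternating-shift c x (suc y) = trans (cong (λ z → c * alternating 1ℤ z) (ℕ.+-suc x y))
    (trans (sym (ℤ.neg-distribʳ-* c (alternating 1ℤ (x ℕ.+ y))))
      (cong -_ (alternating-shift c x y)))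

  alternating-1² : ∀ x → alternating 1ℤ x * alternating 1ℤ x ≡ 1ℤ
  alternating-1² zero    = refl
  alternating-1² (suc x) = trans (lemma (alternating 1ℤ x)) (alternating-1² x)
    where
    lemma : ∀ a → - a * - a ≡ a * a
    lemma = solve-∀

  -- Arithmetic modulo p

  module Congruence (p : ℕ) .{{_ : NonZero p}} where

    infix 4 _≋_ _≋?_
    data _≋_ (a b : ℤ) : Set where
      multiple : ∀ k → a ≡ b + k * + p → a ≋ b

    ≋-reflexive : ∀ {a b} → a ≡ b → a ≋ b
    ≋-reflexive {a} {b} refl = multiple 0ℤ (sym (ℤ.+-identityʳ a))

    ≋-refl : ∀ {a} → a ≋ a
    ≋-refl = ≋-reflexive refl

    ≋-sym : ∀ {a b} → a ≋ b → b ≋ a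
    ≋-sym {b = b} (multiple k refl) = multiple (- k) (lemma b k (+ p))
      where
      lemma : ∀ b k n → b ≡ b + k * n + - k * n
      lemma = solve-∀

    ≋-trans : ∀ {a b c} → a ≋ b → b ≋ c → a ≋ c
    ≋-trans {c = c} (multiple k refl) (multiple l refl) = multiple (l + k) (lemma c k l (+ p))
      where
      lemma : ∀ c k l n → c + l * n + k * n ≡ c + (l + k) * n
      lemma = solve-∀

    +-cong : ∀ {a b c d} → a ≋ b → c ≋ d → a + c ≋ b + d
    +-cong {b = b} {d = d} (multiple k refl) (multiple l refl) =
      multiple (k + l) (lemma b d k l (+ p))
      where
      lemma : ∀ b d k l n → b + k * n + (d + l * n) ≡ b + d + (k + l) * n
      lemma = solve-∀

    *-congˡ : ∀ c {a b} → a ≋ b → c * a ≋ c * b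
    *-congˡ c {b = b} (multiple k refl) = multiple (c * k) (lemma b c k (+ p))
      where
      lemma : ∀ b c k n → c * (b + k * n) ≡ c * b + c * k * n
      lemma = solve-∀

    *-cong : ∀ {a b c d} → a ≋ b → c ≋ d → a * c ≋ b * d
    *-cong {a} {b} {c} {d} e f = ≋-trans (*-congˡ a f)
      (subst₂ _≋_ (ℤ.*-comm d a) (ℤ.*-comm d b) (*-congˡ d e))

    -‿cong : ∀ {a b} → a ≋ b → - a ≋ - b
    -‿cong {a} {b} e = subst₂ _≋_ (ℤ.-1*i≡-i a) (ℤ.-1*i≡-i b) (*-congˡ -1ℤ e)

    minus-cong : ∀ {a b c d} → a ≋ b → c ≋ d → a - c ≋ b - d
    minus-cong e f = +-cong e (-‿cong f)

    ≋-setoid : Setoid _ _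
    ≋-setoid = record
      { _≈_ = _≋_
      ; isEquivalence = record { refl = ≋-refl ; sym = ≋-sym ; trans = ≋-trans } }

    module ≋-Reasoning = SetoidReasoning ≋-setoid

    ≋⇒-≋0 : ∀ {a b} → a ≋ b → a - b ≋ 0ℤ
    ≋⇒-≋0 {a} {b} e = subst (a - b ≋_) (ℤ.+-inverseʳ b) (+-cong e ≋-refl)

    -≋0⇒≋ : ∀ {a b} → a - b ≋ 0ℤ → a ≋ b
    -≋0⇒≋ {a} {b} (multiple k e) =
      multiple k (trans (lemma a b)
        (trans (cong (λ t → b + t) e) (cong (λ t → b + t) (ℤ.+-identityˡ _))))
      where
      lemma : ∀ a b → a ≡ b + (a - b)
      lemma = solve-∀

    -- The working form of elimination modulo p: x - y is exhibited as an integer combination of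
    -- differences that vanish modulo p, so that only a polynomial identity remains for the ring
    -- solver.
    linear₁ : ∀ {x y a b} k → x - y ≡ k * (a - b) → a ≋ b → x ≋ y
    linear₁ {a = a} {b} k eq e = -≋0⇒≋ (subst₂ _≋_ (sym eq) (ℤ.*-zeroʳ k) (*-congˡ k (≋⇒-≋0 e)))

    linear₂ : ∀ {x y a b c d} k l → x - y ≡ k * (a - b) + l * (c - d) → a ≋ b → c ≋ d → x ≋ y
    linear₂ k l eq e f =
      -≋0⇒≋ (subst₂ _≋_ (sym eq) (cong₂ _+_ (ℤ.*-zeroʳ k) (ℤ.*-zeroʳ l))
        (+-cong (*-congˡ k (≋⇒-≋0 e)) (*-congˡ l (≋⇒-≋0 f))))

    p≋0 : + p ≋ 0ℤ
    p≋0 = multiple 1ℤ (sym (trans (ℤ.+-identityˡ _) (ℤ.*-identityˡ (+ p))))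

    ≋0⇒∣ : ∀ {a} → a ≋ 0ℤ → p ℕ.∣ ∣ a ∣
    ≋0⇒∣ (multiple k refl) =
      ℕ.divides ∣ k ∣ (trans (cong ∣_∣ (ℤ.+-identityˡ (k * + p))) (ℤ.abs-* k (+ p)))

    ∣⇒≋0 : ∀ {a} → p ℕ.∣ ∣ a ∣ → a ≋ 0ℤ
    ∣⇒≋0 h with divides k eq ← ∣ᵤ⇒∣ h = multiple k (trans eq (sym (ℤ.+-identityˡ _)))

    _≋?_ : ∀ a b → Dec (a ≋ b)
    a ≋? b = map′ (-≋0⇒≋ ∘ ∣⇒≋0) (≋0⇒∣ ∘ ≋⇒-≋0) (p ℕ.∣? ∣ a - b ∣)

    small≋0⇒≡0 : ∀ {n} → n ℕ.< p → + n ≋ 0ℤ → n ≡ 0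
    small≋0⇒≡0 {zero} _ _ = refl
    small≋0⇒≡0 {suc n} n<p e = contradiction n<p (ℕ.≤⇒≯ (ℕ.∣⇒≤ (≋0⇒∣ e)))

    small-≋⇒≡ : ∀ {m n} → m ℕ.< p → n ℕ.< p → + m ≋ + n → m ≡ n
    small-≋⇒≡ {m} {n} m<p n<p e = ℤ.+-injective (ℤ.i-j≡0⇒i≡j (+ m) (+ n) (ℤ.∣i∣≡0⇒i≡0
      (small≋0⇒≡0 {∣ + m - + n ∣} bound (∣⇒≋0 (≋0⇒∣ (≋⇒-≋0 e))))))
      where
      bound : ∣ + m - + n ∣ ℕ.< p
      bound = subst (λ d → ∣ d ∣ ℕ.< p) (sym (ℤ.m-n≡m⊖n m n))
                (ℕ.≤-<-trans (ℤ.∣m⊝n∣≤m⊔n m n) (ℕ.⊔-pres-<m m<p n<p))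

    val : Fin p → ℤ
    val c = + toℕ c

    -- On nonnegative integers this computes to the `_mod_` used in `row`, so blocks built with
    -- `red` match rows of residues definitionally.
    red : ℤ → Fin p
    red a = fromℕ< (n%ℕd<d a p)

    val-red : ∀ a → val (red a) ≋ a
    val-red a = ≋-sym (multiple (a /ℕ p) (trans (a≡a%ℕn+[a/ℕn]*n a p)
      (cong (λ t → + t + (a /ℕ p) * + p) (sym (Fin.toℕ-fromℕ< _)))))

    val-injective : ∀ {c d} → val c ≋ val d → c ≡ d
    val-injective {c} {d} e = Fin.toℕ-injective (small-≋⇒≡ (Fin.toℕ<n c) (Fin.toℕ<n d) e)

    red-cong : ∀ {a b} → a ≋ b → red a ≡ red b
    red-cong {a} {b} e = val-injective (≋-trans (val-red a) (≋-trans e (≋-sym (val-red b))))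

    red-val : ∀ c → red (val c) ≡ c
    red-val c = val-injective (val-red (val c))

    module _ (isPrime : Prime p) where

      integral : ∀ a b → a * b ≋ 0ℤ → a ≋ 0ℤ ⊎ b ≋ 0ℤ
      integral a b e with euclidsLemma ∣ a ∣ ∣ b ∣ isPrime (subst (p ℕ.∣_) (ℤ.abs-* a b) (≋0⇒∣ e))
      ... | inj₁ h = inj₁ (∣⇒≋0 h)
      ... | inj₂ h = inj₂ (∣⇒≋0 h)

      *≉0 : ∀ {a b} → ¬ a ≋ 0ℤ → ¬ b ≋ 0ℤ → ¬ a * b ≋ 0ℤ
      *≉0 a≉0 b≉0 e = [ a≉0 , b≉0 ]′ (integral _ _ e)

      *≋0⇒≋0ʳ : ∀ a {b} → ¬ a ≋ 0ℤ → a * b ≋ 0ℤ → b ≋ 0ℤ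
      *≋0⇒≋0ʳ a {b} a≉0 e with integral a b e
      ... | inj₁ h = contradiction h a≉0
      ... | inj₂ h = h

      *-cancelˡ : ∀ c {a b} → ¬ c ≋ 0ℤ → c * a ≋ c * b → a ≋ b
      *-cancelˡ c {a} {b} c≉0 e = -≋0⇒≋ (*≋0⇒≋0ʳ c c≉0 (subst (_≋ 0ℤ) (lemma c a b) (≋⇒-≋0 e)))
        where
        lemma : ∀ c a b → c * a - c * b ≡ c * (a - b)
        lemma = solve-∀

  -- Sequences satisfying two first-order recurrences modulo p

  module Recurrence (p : ℕ) .{{_ : NonZero p}} (isPrime : Prime p) where

    open Congruence p

    -- This is `binom-rec` seen through a window: α stands for its first position and j for its row
    -- number, both modulo p.
    Satisfies : ℕ → (ℕ → ℤ) → ℤ → ℤ → Set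
    Satisfies m w α j = ∀ y → suc y ℕ.< m → (1ℤ + (α + + y)) * w (suc y) + (α + + y) * w y ≋ j * w y

    -- The difference of the recurrences for (α , j) and (α′ , j′) makes w a geometric progression;
    -- if its ratio is nonzero, two consecutive steps of the first recurrence force the ratio -1.
    two-recurrences : ∀ {m w α j α′ j′} → 3 ℕ.≤ m → Satisfies m w α j → Satisfies m w α′ j′ →
      (α ≋ α′ × j ≋ j′) ⊎
      (∀ y → suc y ℕ.< m → w y ≋ 0ℤ) ⊎
      (∀ y → suc y ℕ.< m → w (suc y) ≋ 0ℤ) ⊎
      (∀ y → suc y ℕ.< m → w (suc y) ≋ - w y)
    two-recurrences {m} {w} {α} {j} {α′} {j′} 3≤m rec rec′ = cases
      where
      δ = α - α′
      ε = j - j′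
      difference : ∀ y → suc y ℕ.< m → δ * w (suc y) + δ * w y ≋ ε * w y
      difference y h = linear₂ 1ℤ -1ℤ (identity α α′ j j′ (+ y) (w y) (w (suc y))) (rec y h)
        (rec′ y h)
        where
        identity : ∀ α α′ j j′ y a b → ((α - α′) * b + (α - α′) * a) - (j - j′) * a ≡
          1ℤ * (((1ℤ + (α + y)) * b + (α + y) * a) - j * a) + -1ℤ
            * (((1ℤ + (α′ + y)) * b + (α′ + y) * a) - j′ * a)
        identity = solve-∀
      εw≋0 : δ ≋ 0ℤ → ∀ y → suc y ℕ.< m → ε * w y ≋ 0ℤ
      εw≋0 δ≋0 y h = linear₂ -1ℤ (w (suc y) + w y) (identity δ ε (w y) (w (suc y))) (difference y h)
        δ≋0
        where
        identity : ∀ δ ε a b → ε * a - 0ℤ ≡ -1ℤ * ((δ * b + δ * a) - ε * a) + (b + a) * (δ - 0ℤ)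
        identity = solve-∀
      ratio : ∀ y → suc y ℕ.< m → δ * w (suc y) ≋ (ε - δ) * w y
      ratio y h = linear₁ 1ℤ (identity δ ε (w y) (w (suc y))) (difference y h)
        where
        identity : ∀ δ ε a b → δ * b - (ε - δ) * a ≡ 1ℤ * ((δ * b + δ * a) - ε * a)
        identity = solve-∀
      0<1 : 1 ℕ.< m
      0<1 = ℕ.≤-trans (ℕ.n≤1+n 2) 3≤m
      -- Multiplying the recurrence by δ and replacing δ w(y + 1) with the help of `difference`
      -- leaves w y times this bracket.
      bracket : ∀ y → suc y ℕ.< m → ¬ w y ≋ 0ℤ →
        (1ℤ + (α + + y)) * (ε - δ) + (α + + y) * δ - j * δ ≋ 0ℤ
      bracket y h wy≉0 = *≋0⇒≋0ʳ isPrime (w y) wy≉0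
        (linear₂ δ (- (1ℤ + (α + + y))) (identity δ ε (α + + y) j (w y) (w (suc y))) (rec y h)
          (difference y h))
        where
        identity : ∀ δ ε a j u v → u * ((1ℤ + a) * (ε - δ) + a * δ - j * δ) - 0ℤ ≡
          δ * (((1ℤ + a) * v + a * u) - j * u) + - (1ℤ + a) * ((δ * v + δ * u) - ε * u)
        identity = solve-∀
      -- The bracket is affine in y with slope (ε - δ) + δ = ε, so its vanishing at y = 0 and y = 1
      -- forces ε to vanish. The step y = 1 exists because m ≥ 3.
      ε≋0 : ¬ w 0 ≋ 0ℤ → ¬ w 1 ≋ 0ℤ → ε ≋ 0ℤ
      ε≋0 w0≉0 w1≉0 = linear₂ 1ℤ -1ℤ (identity α j δ ε) (bracket 1 3≤m w1≉0) (bracket 0 0<1 w0≉0)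
        where
        identity : ∀ α j δ ε → ε - 0ℤ ≡
          1ℤ * ((1ℤ + (α + 1ℤ)) * (ε - δ) + (α + 1ℤ) * δ - j * δ - 0ℤ) +
          -1ℤ * ((1ℤ + (α + 0ℤ)) * (ε - δ) + (α + 0ℤ) * δ - j * δ - 0ℤ)
        identity = solve-∀
      0≋⇒ : ∀ c {a} → a ≋ 0ℤ → c * a ≋ 0ℤ
      0≋⇒ c {a} e = subst (c * a ≋_) (ℤ.*-zeroʳ c) (*-congˡ c e)
      cases : _
      cases with δ ≋? 0ℤ
      ... | yes δ≋0 with ε ≋? 0ℤ
      ...   | yes ε≋0 = inj₁ (-≋0⇒≋ δ≋0 , -≋0⇒≋ ε≋0)
      -- Without δ the difference reads ε w y ≋ 0, which leaves only the last entry free.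
      ...   | no  ε≉0 = inj₂ (inj₁ λ y h → *≋0⇒≋0ʳ isPrime ε ε≉0 (εw≋0 δ≋0 y h))
      cases | no δ≉0 with (ε - δ) ≋? 0ℤ | w 0 ≋? 0ℤ
      ...   | yes e | _ = inj₂ (inj₂ (inj₁ λ y h → *≋0⇒≋0ʳ isPrime δ δ≉0 (≋-trans (ratio y h)
                            (subst₂ _≋_ (ℤ.*-comm (w y) (ε - δ)) (ℤ.*-zeroʳ (w y))
                              (*-congˡ (w y) e)))))
      -- A progression starting at 0 vanishes entirely and is filed under the blocks that vanish
      -- before their last entry.
      ...   | no ne | yes w0≋0 = inj₂ (inj₁ λ y h → vanishes y (ℕ.<-trans (ℕ.n<1+n y) h))
        where
        vanishes : ∀ y → y ℕ.< m → w y ≋ 0ℤ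
        vanishes zero    _ = w0≋0
        vanishes (suc y) h = *≋0⇒≋0ʳ isPrime δ δ≉0
          (≋-trans (ratio y h) (0≋⇒ (ε - δ) (vanishes y (ℕ.<-trans (ℕ.n<1+n y) h))))
      ...   | no ne | no w0≉0 = inj₂ (inj₂ (inj₂ λ y h → *-cancelˡ isPrime δ δ≉0
                  (linear₂ 1ℤ (w y) (identity δ ε (w y) (w (suc y))) (difference y h)
                    (ε≋0 w0≉0 w1≉0))))
        where
        w1≉0 : ¬ w 1 ≋ 0ℤ
        w1≉0 w1≋0 = *≉0 isPrime ne w0≉0 (≋-trans (≋-sym (ratio 0 0<1)) (0≋⇒ δ w1≋0))
        identity : ∀ δ ε a b → δ * b - δ * - a ≡ 1ℤ * ((δ * b + δ * a) - ε * a) + a * (ε - 0ℤ)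
        identity = solve-∀

  module PascalModulo (p : ℕ) .{{_ : NonZero p}} (isPrime : Prime p) (3≤p : 3 ℕ.≤ p) where

    open Congruence p
    open Recurrence p isPrime

    -- Lucas's theorem

    q : ℕ
    q = ℕ.pred p

    1+q≡p : suc q ≡ p
    1+q≡p = ℕ.suc-pred p

    q<p : q ℕ.< p
    q<p = ℕ.≤-reflexive 1+q≡p

    0<p : 0 ℕ.< p
    0<p = ℕ.<-≤-trans z<s 3≤p

    small≉0 : ∀ {n} → 0 ℕ.< n → n ℕ.< p → ¬ + n ≋ 0ℤ
    small≉0 0<n n<p e = ℕ.<⇒≢ 0<n (sym (small≋0⇒≡0 n<p e))

    1≉0 : ¬ 1ℤ ≋ 0ℤ
    1≉0 = small≉0 z<s (ℕ.<-≤-trans (s<s z<s) 3≤p)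

    p*≋0 : ∀ x → + (p ℕ.* x) ≋ 0ℤ
    p*≋0 x = subst₂ _≋_ (trans (ℤ.*-comm (+ x) (+ p)) (sym (ℤ.pos-* p x))) (ℤ.*-zeroʳ (+ x))
      (*-congˡ (+ x) p≋0)

    p*x+l≋l : ∀ x l → + (p ℕ.* x ℕ.+ l) ≋ + l
    p*x+l≋l x l = subst (+ (p ℕ.* x ℕ.+ l) ≋_) (ℤ.+-identityˡ (+ l))
      (+-cong (p*≋0 x) (≋-refl {+ l}))

    -- As sequences in l, both sides obey `binom-rec` with coefficients that agree modulo p. The
    -- leading coefficient l + 1 is invertible while l + 1 < p, so agreement at l = 0 propagates
    -- through the period.
    binom-period : ∀ n j x → + n ≋ + j → ∀ l → l ℕ.< p →
                   binom n (p ℕ.* x ℕ.+ l) ≋ binom n (p ℕ.* x) * binom j l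
    binom-period n j x n≋j zero _ =
      ≋-reflexive (trans (cong (binom n) (ℕ.+-identityʳ (p ℕ.* x))) (sym (ℤ.*-identityʳ _)))
    binom-period n j x n≋j (suc l) l<p rewrite ℕ.+-suc (p ℕ.* x) l =
      *-cancelˡ isPrime (+ suc l) (small≉0 z<s l<p)
        (step {b′ = binom j (suc l)} {binom n (p ℕ.* x)} (p*x+l≋l x l) n≋j
          (binom-period n j x n≋j l (ℕ.<-trans (ℕ.n<1+n l) l<p))
          (binom-rec n (p ℕ.* x ℕ.+ l)) (binom-rec j l))
      where
      lemma₁ : ∀ z a b → (1ℤ + z) * b ≡ (1ℤ + z) * b + z * a - z * a
      lemma₁ = solve-∀
      lemma₂ : ∀ z n a → n * a - z * a ≡ (n - z) * a
      lemma₂ = solve-∀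
      lemma₃ : ∀ z n a t → (n - z) * (t * a) ≡ t * ((n - z) * a)
      lemma₃ = solve-∀
      lemma₄ : ∀ z b t → t * ((1ℤ + z) * b) ≡ (1ℤ + z) * (t * b)
      lemma₄ = solve-∀
      solved : ∀ z n {a b} → (1ℤ + z) * b + z * a ≡ n * a → (1ℤ + z) * b ≡ (n - z) * a
      solved z n {a} {b} e = trans (lemma₁ z a b) (trans (cong (λ t → t - z * a) e) (lemma₂ z n a))
      step : ∀ {z z′ n n′ a a′ b b′ t} → z ≋ z′ → n ≋ n′ → a ≋ t * a′ →
             (1ℤ + z) * b + z * a ≡ n * a → (1ℤ + z′) * b′ + z′ * a′ ≡ n′ * a′ →
             (1ℤ + z′) * b ≋ (1ℤ + z′) * (t * b′)
      step {z} {z′} {n} {n′} {a} {a′} {b} {b′} {t} ez en ea e e′ = begin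
        (1ℤ + z′) * b          ≈⟨ *-cong (+-cong (≋-refl {1ℤ}) ez) (≋-refl {b}) ⟨
        (1ℤ + z) * b           ≡⟨ solved z n e ⟩
        (n - z) * a            ≈⟨ *-cong (minus-cong en ez) ea ⟩
        (n′ - z′) * (t * a′)   ≡⟨ lemma₃ z′ n′ a′ t ⟩
        t * ((n′ - z′) * a′)   ≡⟨ cong (λ s → t * s) (solved z′ n′ e′) ⟨
        t * ((1ℤ + z′) * b′)   ≡⟨ lemma₄ z′ b′ t ⟩
        (1ℤ + z′) * (t * b′)   ∎
        where
        open ≋-Reasoning

    p*suc : ∀ x → p ℕ.* suc x ≡ suc (p ℕ.* x ℕ.+ q)
    p*suc x = begin
      p ℕ.* suc x        ≡⟨ ℕ.*-suc p x ⟩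
      p ℕ.+ p ℕ.* x      ≡⟨ ℕ.+-comm p _ ⟩
      p ℕ.* x ℕ.+ p      ≡⟨ cong (λ t → p ℕ.* x ℕ.+ t) 1+q≡p ⟨
      p ℕ.* x ℕ.+ suc q  ≡⟨ ℕ.+-suc _ q ⟩
      suc (p ℕ.* x ℕ.+ q) ∎
      where open ≡-Reasoning

    -- Induction on the row number by Pascal's rule. The left neighbour of position p(x + 1) is the
    -- last place px + q of the previous period. It contributes a multiple of C(j,q), which is 0 for
    -- j < q, so the entry stays unchanged until the row number passes a multiple of p; there C(q,q)
    -- = 1 and Pascal's rule for row i is reproduced.
    binom-multiples : ∀ i j → j ℕ.< p → ∀ x → binom (p ℕ.* i ℕ.+ j) (p ℕ.* x) ≋ binom i x
    binom-multiples i j _ zero rewrite ℕ.*-zeroʳ p = ≋-refl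
    binom-multiples zero j j<p (suc x) rewrite ℕ.*-zeroʳ p =
      ≋-reflexive (binom-above (ℕ.<-≤-trans j<p (ℕ.m≤m*n p (suc x))))
    binom-multiples (suc i) zero _ (suc x) = begin
      binom (p ℕ.* suc i ℕ.+ 0) (p ℕ.* suc x)
        ≡⟨ cong₂ binom (trans (ℕ.+-identityʳ _) (p*suc i)) (p*suc x) ⟩
      binom n (p ℕ.* x ℕ.+ q) + binom n (suc (p ℕ.* x ℕ.+ q))
        ≈⟨ +-cong (≋-trans (binom-period n q x (p*x+l≋l i q) q q<p)
                           (*-cong {d = 1ℤ} (binom-multiples i q q<p x)
                             (≋-reflexive (binom-diag q))))
                  (≋-trans (≋-reflexive (cong (binom n) (sym (p*suc x))))
                    (binom-multiples i q q<p (suc x))) ⟩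
      binom i x * 1ℤ + binom i (suc x)
        ≡⟨ cong (λ t → t + binom i (suc x)) (ℤ.*-identityʳ (binom i x)) ⟩
      binom i x + binom i (suc x) ∎
      where
      open ≋-Reasoning
      n = p ℕ.* i ℕ.+ q
    binom-multiples (suc i) (suc j) 1+j<p (suc x) = begin
      binom (p ℕ.* suc i ℕ.+ suc j) (p ℕ.* suc x)
        ≡⟨ cong₂ binom (ℕ.+-suc _ j) (p*suc x) ⟩
      binom n (p ℕ.* x ℕ.+ q) + binom n (suc (p ℕ.* x ℕ.+ q))
        ≈⟨ +-cong (≋-trans (binom-period n j x (p*x+l≋l (suc i) j) q q<p)
                           (*-congˡ (binom n (p ℕ.* x)) (≋-reflexive (binom-above j<q))))
                  (≋-trans (≋-reflexive (cong (binom n) (sym (p*suc x))))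
                    (binom-multiples (suc i) j j<p (suc x))) ⟩
      binom n (p ℕ.* x) * 0ℤ + binom (suc i) (suc x)
        ≡⟨ cong (λ t → t + binom (suc i) (suc x)) (ℤ.*-zeroʳ (binom n (p ℕ.* x))) ⟩
      0ℤ + binom (suc i) (suc x)
        ≡⟨ ℤ.+-identityˡ _ ⟩
      binom (suc i) (suc x) ∎
      where
      open ≋-Reasoning
      n = p ℕ.* suc i ℕ.+ j
      j<p = ℕ.<-trans (ℕ.n<1+n j) 1+j<p
      j<q : j ℕ.< q
      j<q = ℕ.s<s⁻¹ (subst (suc j ℕ.<_) (sym 1+q≡p) 1+j<p)

    -- For P a power of p, this treats several base-p digits as one.
    LucasFor : ℕ → Set
    LucasFor P = ∀ i j x l → j ℕ.< P → l ℕ.< P →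
                 binom (P ℕ.* i ℕ.+ j) (P ℕ.* x ℕ.+ l) ≋ binom i x * binom j l

    lucas : LucasFor p
    lucas i j x l j<p l<p = ≋-trans (binom-period (p ℕ.* i ℕ.+ j) j x (p*x+l≋l i j) l l<p)
      (*-cong (binom-multiples i j j<p x) ≋-refl)

    divMod : ∀ n → n ≡ p ℕ.* (n ℕ./ p) ℕ.+ n ℕ.% p
    divMod n = trans (ℕ.m≡m%n+[m/n]*n n p)
      (trans (ℕ.+-comm (n ℕ.% p) _) (cong (λ t → t ℕ.+ n ℕ.% p) (ℕ.*-comm (n ℕ./ p) p)))

    -- `lucas` strips the last base-p digits j₀ and l₀, the hypothesis handles what is left, and
    -- `lucas` in reverse reassembles the coefficient of j and l.
    lucas-* : ∀ {P} → LucasFor P → LucasFor (p ℕ.* P)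
    lucas-* {P} lucasP i j x l j<pP l<pP = begin
      binom (p ℕ.* P ℕ.* i ℕ.+ j) (p ℕ.* P ℕ.* x ℕ.+ l)
        ≡⟨ cong₂ binom (regroup i j) (regroup x l) ⟩
      binom (p ℕ.* (P ℕ.* i ℕ.+ j₁) ℕ.+ j₀) (p ℕ.* (P ℕ.* x ℕ.+ l₁) ℕ.+ l₀)
        ≈⟨ lucas _ j₀ _ l₀ (ℕ.m%n<n j p) (ℕ.m%n<n l p) ⟩
      binom (P ℕ.* i ℕ.+ j₁) (P ℕ.* x ℕ.+ l₁) * binom j₀ l₀
        ≈⟨ *-cong (lucasP i j₁ x l₁ (quot< j<pP) (quot< l<pP)) ≋-refl ⟩
      binom i x * binom j₁ l₁ * binom j₀ l₀
        ≡⟨ ℤ.*-assoc (binom i x) _ _ ⟩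
      binom i x * (binom j₁ l₁ * binom j₀ l₀)
        ≈⟨ *-congˡ (binom i x) (lucas j₁ j₀ l₁ l₀ (ℕ.m%n<n j p) (ℕ.m%n<n l p)) ⟨
      binom i x * binom (p ℕ.* j₁ ℕ.+ j₀) (p ℕ.* l₁ ℕ.+ l₀)
        ≡⟨ cong₂ (λ s t → binom i x * binom s t) (divMod j) (divMod l) ⟨
      binom i x * binom j l ∎
      where
      open ≋-Reasoning
      j₁ = j ℕ./ p
      j₀ = j ℕ.% p
      l₁ = l ℕ./ p
      l₀ = l ℕ.% p
      regroup : ∀ a b → p ℕ.* P ℕ.* a ℕ.+ b ≡ p ℕ.* (P ℕ.* a ℕ.+ b ℕ./ p) ℕ.+ b ℕ.% p
      regroup a b = trans (cong₂ ℕ._+_ (ℕ.*-assoc p P a) (divMod b))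
        (trans (sym (ℕ.+-assoc (p ℕ.* (P ℕ.* a)) _ _))
          (cong (λ t → t ℕ.+ b ℕ.% p) (sym (ℕ.*-distribˡ-+ p (P ℕ.* a) (b ℕ./ p)))))
      quot< : ∀ {b} → b ℕ.< p ℕ.* P → b ℕ./ p ℕ.< P
      quot< {b} b<pP = ℕ.m<n*o⇒m/o<n (subst (b ℕ.<_) (ℕ.*-comm p P) b<pP)

    -- Powers of p outgrow b. One factor p is kept apart so that a shift by a multiple of p P
    -- visibly preserves residues modulo p.
    lucas-large : ∀ b → ∃ λ P → b ℕ.< P × LucasFor (p ℕ.* P)
    lucas-large zero = 1 , z<s , subst LucasFor (sym (ℕ.*-identityʳ p)) lucas
    lucas-large (suc b) with P , b<P , lucasP ← lucas-large b =
      p ℕ.* P , bound , lucas-* lucasP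
      where
      open ℕ.≤-Reasoning
      bound : suc b ℕ.< p ℕ.* P
      bound = begin-strict
        suc b ≤⟨ b<P ⟩
        P <⟨ ℕ.m<n+m P (ℕ.≤-<-trans z≤n b<P) ⟩
        P ℕ.+ P ≡⟨ cong (λ t → P ℕ.+ t) (ℕ.+-identityʳ P) ⟨
        2 ℕ.* P ≤⟨ ℕ.*-monoˡ-≤ P (ℕ.≤-trans (ℕ.n≤1+n 2) 3≤p) ⟩
        p ℕ.* P ∎

    -- Row P(p + c) + i, for P a large power of p, carries at distance P a copy of row i scaled by
    -- C(p + c, 1) ≡ c, with zeros on both sides of it.
    shifted-copy : ∀ i x m c → ∃ λ u → ∃ λ v →
      (p ℕ.* suc v ℕ.+ x ℕ.+ m ℕ.≤ p ℕ.* u ℕ.+ i) ×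
      (∀ y → y ℕ.< m → binom (p ℕ.* u ℕ.+ i) (p ℕ.* suc v ℕ.+ x ℕ.+ y) ≋ + c * binom i (x ℕ.+ y))
    shifted-copy i x m c with lucas-large (i ℕ.+ (x ℕ.+ m))
    -- The summand p leaves c unchanged modulo p and makes the row number at least 2P, so that the
    -- window fits into the row even for c = 0.
    ... | suc v , b<P , lucasP = suc v ℕ.* (p ℕ.+ c) , v , fits , copy
      where
      P = p ℕ.* suc v
      v<P : suc v ℕ.≤ P
      v<P = ℕ.m≤n*m (suc v) p
      i<P : i ℕ.< P
      i<P = ℕ.<-≤-trans (ℕ.≤-<-trans (ℕ.m≤m+n i _) b<P) v<P
      x+m<P : x ℕ.+ m ℕ.< P
      x+m<P = ℕ.<-≤-trans (ℕ.≤-<-trans (ℕ.m≤n+m _ i) b<P) v<P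
      fits : P ℕ.+ x ℕ.+ m ℕ.≤ p ℕ.* (suc v ℕ.* (p ℕ.+ c)) ℕ.+ i
      fits = begin
        P ℕ.+ x ℕ.+ m     ≡⟨ ℕ.+-assoc P x m ⟩
        P ℕ.+ (x ℕ.+ m)   ≤⟨ ℕ.+-monoʳ-≤ P (ℕ.<⇒≤ x+m<P) ⟩
        P ℕ.+ P           ≡⟨ cong (λ t → P ℕ.+ t) (ℕ.+-identityʳ P) ⟨
        2 ℕ.* P           ≡⟨ ℕ.*-comm 2 P ⟩
        P ℕ.* 2           ≤⟨ ℕ.*-monoʳ-≤ P (ℕ.≤-trans (ℕ.≤-trans (ℕ.n≤1+n 2) 3≤p) (ℕ.m≤m+n p c)) ⟩
        P ℕ.* (p ℕ.+ c)   ≡⟨ ℕ.*-assoc p (suc v) (p ℕ.+ c) ⟩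
        p ℕ.* (suc v ℕ.* (p ℕ.+ c))       ≤⟨ ℕ.m≤m+n _ i ⟩
        p ℕ.* (suc v ℕ.* (p ℕ.+ c)) ℕ.+ i ∎
        where open ℕ.≤-Reasoning
      copy : ∀ y → y ℕ.< m → binom (p ℕ.* (suc v ℕ.* (p ℕ.+ c)) ℕ.+ i) (P ℕ.+ x ℕ.+ y)
        ≋ + c * binom i (x ℕ.+ y)
      copy y y<m = begin
        binom (p ℕ.* (suc v ℕ.* (p ℕ.+ c)) ℕ.+ i) (P ℕ.+ x ℕ.+ y)
          ≡⟨ cong₂ binom (cong (λ t → t ℕ.+ i) (sym (ℕ.*-assoc p (suc v) (p ℕ.+ c))))
                         (trans (ℕ.+-assoc P x y)
                           (cong (λ t → t ℕ.+ (x ℕ.+ y)) (sym (ℕ.*-identityʳ P)))) ⟩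
        binom (P ℕ.* (p ℕ.+ c) ℕ.+ i) (P ℕ.* 1 ℕ.+ (x ℕ.+ y))
          ≈⟨ lucasP (p ℕ.+ c) i 1 (x ℕ.+ y) i<P (ℕ.<-trans (ℕ.+-monoʳ-< x y<m) x+m<P) ⟩
        binom (p ℕ.+ c) 1 * binom i (x ℕ.+ y)
          ≈⟨ *-cong (≋-trans
            (≋-reflexive (trans (binom-1 (p ℕ.+ c))
              (cong (λ t → + (t ℕ.+ c)) (sym (ℕ.*-identityʳ p))))) (p*x+l≋l 1 c)) ≋-refl ⟩
        + c * binom i (x ℕ.+ y) ∎
        where open ≋-Reasoning

    -- Blocks as windows of rows

    Block : ℕ → Set
    Block = Vec (Fin p)

    at : ∀ {m} → Block m → ℕ → ℤ
    at []      _       = 0ℤ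
    at (c ∷ w) zero    = val c
    at (c ∷ w) (suc y) = at w y

    block : ∀ m → (ℕ → ℤ) → Block m
    block zero    f = []
    block (suc m) f = red (f 0) ∷ block m (f ∘ suc)

    at-block : ∀ {m y} f → y ℕ.< m → at (block m f) y ≋ f y
    at-block {suc m} {zero}  f _         = val-red (f 0)
    at-block {suc m} {suc y} f (s<s y<m) = at-block (f ∘ suc) y<m

    block-cong : ∀ {m f g} → (∀ y → y ℕ.< m → f y ≋ g y) → block m f ≡ block m g
    block-cong {zero}  _ = refl
    block-cong {suc m} e = cong₂ _∷_ (red-cong (e 0 z<s))
      (block-cong (λ y y<m → e (suc y) (s<s y<m)))

    block-injective : ∀ {m f g} → block m f ≡ block m g → ∀ {y} → y ℕ.< m → f y ≋ g y
    block-injective {f = f} {g} e {y} y<m =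
      ≋-trans (≋-sym (at-block f y<m)) (subst (λ w → at w y ≋ g y) (sym e) (at-block g y<m))

    block-at : ∀ {m} (w : Block m) → block m (at w) ≡ w
    block-at []      = refl
    block-at (c ∷ w) = cong₂ _∷_ (red-val c) (block-at w)

    ≡block : ∀ {m f} (w : Block m) → (∀ y → y ℕ.< m → at w y ≋ f y) → w ≡ block m f
    ≡block w e = trans (sym (block-at w)) (block-cong e)

    -- Positions past the end of the row read as 0, so a window need not fit into its row; by
    -- `window-accessible` this produces no additional blocks.
    window : ∀ m → ℕ → ℕ → Block m
    window m n x = block m (λ y → binom n (x ℕ.+ y))

    scaled-window : ∀ n x m c → ∃ λ u → ∃ λ v →
      (p ℕ.* suc v ℕ.+ x ℕ.+ m ℕ.≤ p ℕ.* u ℕ.+ n) ×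
      window m (p ℕ.* u ℕ.+ n) (p ℕ.* suc v ℕ.+ x) ≡ block m (λ y → + c * binom n (x ℕ.+ y))
    scaled-window n x m c with u , v , fits , copy ← shifted-copy n x m c =
      u , v , fits , block-cong copy

    -- The case c = 1 removes all boundary conditions: the new window fits into its row and starts
    -- at a position of at least p, while row number and position keep their residues.
    padded-window : ∀ n x m → ∃ λ u → ∃ λ v →
      (p ℕ.* suc v ℕ.+ x ℕ.+ m ℕ.≤ p ℕ.* u ℕ.+ n) ×
      window m (p ℕ.* u ℕ.+ n) (p ℕ.* suc v ℕ.+ x) ≡ window m n x
    padded-window n x m with u , v , fits , e ← scaled-window n x m 1 =
      u , v , fits , trans e (block-cong (λ y _ → ≋-reflexive (ℤ.*-identityˡ (binom n (x ℕ.+ y)))))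

    residues : List ℕ → List (Fin p)
    residues = List.map (λ c → c mod p)

    factor⇒block : ∀ {m} u (w : Block m) v f → u ++ toList w ++ v ≡ residues f →
                   w ≡ block m (λ y → coef f (length u ℕ.+ y))
    factor⇒block []      []      v f       e = refl
    factor⇒block []      (c ∷ w) v (a ∷ f) e =
      cong₂ _∷_ (List.∷-injectiveˡ e) (factor⇒block [] w v f (List.∷-injectiveʳ e))
    factor⇒block (d ∷ u) w       v (a ∷ f) e = factor⇒block u w v f (List.∷-injectiveʳ e)

    block⇒prefix : ∀ m f → m ℕ.≤ length f → ∃ λ v → toList (block m (coef f)) ++ v ≡ residues f
    block⇒prefix zero    f       _       = residues f , refl
    block⇒prefix (suc m) (a ∷ f) (s≤s h) with v , e ← block⇒prefix m f h = v , cong (a mod p ∷_) e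

    block⇒factor : ∀ x m f → x ℕ.+ m ℕ.≤ length f → ∃ λ u → ∃ λ v →
                   u ++ toList (block m (λ y → coef f (x ℕ.+ y))) ++ v ≡ residues f
    block⇒factor zero    m f       h       = [] , block⇒prefix m f h
    block⇒factor (suc x) m (a ∷ f) (s≤s h) with u , v , e ← block⇒factor x m f h =
      a mod p ∷ u , v , cong (a mod p ∷_) e

    Acc : ∀ {m} → Block m → Set
    Acc {m} = Accessible p onePlusX m

    accessible⇒window : ∀ {m} {w : Block m} → Acc w → ∃ λ n → ∃ λ x → w ≡ window m n x
    accessible⇒window {m} {w} (n , u , v , e) = n , length u ,
      trans (factor⇒block u w v (polyPow onePlusX n) e)
        (block-cong (λ y _ → ≋-reflexive (coef-polyPow n (length u ℕ.+ y))))

    fitting-window-accessible : ∀ {m} n x → x ℕ.+ m ℕ.≤ n → Acc (window m n x)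
    fitting-window-accessible {m} n x h
      with u , v , e ← block⇒factor x m (polyPow onePlusX n)
        (ℕ.≤-trans h (ℕ.≤-trans (ℕ.n≤1+n n) (ℕ.≤-reflexive (sym (length-polyPow n)))))
      = n , u , v , trans (cong (λ w → u ++ toList w ++ v)
          (block-cong {m} (λ y _ → ≋-reflexive (sym (coef-polyPow n (x ℕ.+ y)))))) e

    scaled-window-accessible : ∀ n x m c → Acc (block m (λ y → + c * binom n (x ℕ.+ y)))
    scaled-window-accessible n x m c with u , v , fits , e ← scaled-window n x m c =
      subst Acc e (fitting-window-accessible (p ℕ.* u ℕ.+ n) (p ℕ.* suc v ℕ.+ x) fits)

    window-accessible : ∀ m n x → Acc (window m n x)
    window-accessible m n x with u , v , fits , e ← padded-window n x m =
      subst Acc e (fitting-window-accessible (p ℕ.* u ℕ.+ n) (p ℕ.* suc v ℕ.+ x) fits)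

    -- Windows with prescribed residues

    n/p : ∀ t {l} → l ℕ.< p → (p ℕ.* t ℕ.+ l) ℕ./ p ≡ t
    n/p t {l} l<p = begin
      (p ℕ.* t ℕ.+ l) ℕ./ p        ≡⟨ ℕ.+-distrib-/-∣ˡ l (ℕ.m∣m*n t) ⟩
      p ℕ.* t ℕ./ p ℕ.+ l ℕ./ p    ≡⟨ cong₂ ℕ._+_ (trans (ℕ./-congˡ (ℕ.*-comm p t)) (ℕ.m*n/n≡m t p))
        (ℕ.m<n⇒m/n≡0 l<p) ⟩
      t ℕ.+ 0                      ≡⟨ ℕ.+-identityʳ t ⟩
      t                            ∎
      where
      open ≡-Reasoning

    n%p : ∀ t {l} → l ℕ.< p → (p ℕ.* t ℕ.+ l) ℕ.% p ≡ l
    n%p t {l} l<p = trans (ℕ.%-remove-+ˡ l (ℕ.m∣m*n t)) (ℕ.m<n⇒m%n≡m l<p)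

    -- If C(j,l + 1) vanished modulo p, `binom-rec` would give l C(j,l) ≡ j C(j,l). By induction
    -- C(j,l) can be cancelled, and l ≡ j is impossible for l < j < p.
    binom-nonzero : ∀ {j} → j ℕ.< p → ∀ l → l ℕ.≤ j → ¬ binom j l ≋ 0ℤ
    binom-nonzero j<p zero _ = 1≉0
    binom-nonzero {j} j<p (suc l) l<j b≋0 = ℕ.<⇒≢ l<j (small-≋⇒≡ (ℕ.<-trans l<j j<p) j<p
      (*-cancelˡ isPrime (binom j l) (binom-nonzero j<p l (ℕ.<⇒≤ l<j))
        (linear₁ (- + suc l) (identity (+ l) (+ j) (binom j l) (binom j (suc l)) (binom-rec j l))
          b≋0)))
      where
      lemma : ∀ l j b b′ → b * l - b * j ≡ ((1ℤ + l) * b′ + l * b) - j * b - (1ℤ + l) * b′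
      lemma = solve-∀
      lemma′ : ∀ l j b b′ → j * b - j * b - (1ℤ + l) * b′ ≡ - (1ℤ + l) * (b′ - 0ℤ)
      lemma′ = solve-∀
      identity : ∀ l j b b′ → (1ℤ + l) * b′ + l * b ≡ j * b → b * l - b * j ≡ - (1ℤ + l) * (b′ - 0ℤ)
      identity l j b b′ e = trans (lemma l j b b′) (trans (cong (λ t → t - j * b - (1ℤ + l) * b′) e)
        (lemma′ l j b b′))

    -- A window of row pn + j starting at position px + r + 1 meets the nonzero part of the first
    -- period [px, px + p) it overlaps exactly when r < j; otherwise that period is skipped.
    skip : Fin p → Fin p → ℕ
    skip r j with toℕ r ℕ.<? toℕ j
    ... | yes _ = 0
    ... | no  _ = 1

    skip-cases : ∀ r j → (toℕ r ℕ.< toℕ j × skip r j ≡ 0) ⊎ (toℕ j ℕ.≤ toℕ r × skip r j ≡ 1)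
    skip-cases r j with toℕ r ℕ.<? toℕ j
    ... | yes r<j = inj₁ (r<j , refl)
    ... | no  r≮j = inj₂ (ℕ.≮⇒≥ r≮j , refl)

    skip≤1 : ∀ r j → skip r j ℕ.≤ 1
    skip≤1 r j with skip-cases r j
    ... | inj₁ (_ , e) = ℕ.≤-trans (ℕ.≤-reflexive e) z≤n
    ... | inj₂ (_ , e) = ℕ.≤-reflexive e

    -- The positions px + r + 1, ..., px + r + m lie in periods with numbers from x to x + (r +
    -- m)/p. The parent has one entry for each of these, less the first if it is skipped. For r = p
    -- - 1 period x is not met at all, but then j ≤ r, and it is the skipped one.
    parentLength : ℕ → Fin p → Fin p → ℕ
    parentLength m r j = suc ((toℕ r ℕ.+ m) ℕ./ p) ℕ.∸ skip r j

    expand : ∀ {m} r j → Block (parentLength m r j) → Block m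
    expand {m} r j v = block m λ y →
      at v ((suc (toℕ r) ℕ.+ y) ℕ./ p ℕ.∸ skip r j) * binom (toℕ j) ((suc (toℕ r) ℕ.+ y) ℕ.% p)

    OccursAt : ∀ {m} → Fin p → Fin p → Block m → Set
    OccursAt {m} r j w = ∃ λ n → ∃ λ x → w ≡ window m (p ℕ.* n ℕ.+ toℕ j) (p ℕ.* x ℕ.+ suc (toℕ r))

    expand-window : ∀ m r j n x →
      expand {m} r j (window (parentLength m r j) n (x ℕ.+ skip r j)) ≡
      window m (p ℕ.* n ℕ.+ toℕ j) (p ℕ.* x ℕ.+ suc (toℕ r))
    expand-window m r j n x = block-cong λ y y<m → ≋-trans (parent y y<m) (≋-sym (child y))
      where
      quot rem : ℕ → ℕ
      quot y = (suc (toℕ r) ℕ.+ y) ℕ./ p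
      rem  y = (suc (toℕ r) ℕ.+ y) ℕ.% p
      position : ∀ y → p ℕ.* x ℕ.+ suc (toℕ r) ℕ.+ y ≡ p ℕ.* (x ℕ.+ quot y) ℕ.+ rem y
      position y = begin
        p ℕ.* x ℕ.+ suc (toℕ r) ℕ.+ y           ≡⟨ ℕ.+-assoc (p ℕ.* x) _ y ⟩
        p ℕ.* x ℕ.+ (suc (toℕ r) ℕ.+ y)         ≡⟨ cong (p ℕ.* x ℕ.+_)
          (divMod (suc (toℕ r) ℕ.+ y)) ⟩
        p ℕ.* x ℕ.+ (p ℕ.* quot y ℕ.+ rem y)    ≡⟨ ℕ.+-assoc (p ℕ.* x) _ _ ⟨
        p ℕ.* x ℕ.+ p ℕ.* quot y ℕ.+ rem y      ≡⟨ cong (ℕ._+ rem y) (ℕ.*-distribˡ-+ p x (quot y)) ⟨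
        p ℕ.* (x ℕ.+ quot y) ℕ.+ rem y          ∎
        where open ≡-Reasoning
      child : ∀ y → binom (p ℕ.* n ℕ.+ toℕ j) (p ℕ.* x ℕ.+ suc (toℕ r) ℕ.+ y)
        ≋ binom n (x ℕ.+ quot y) * binom (toℕ j) (rem y)
      child y = subst (λ z → binom (p ℕ.* n ℕ.+ toℕ j) z ≋ binom n (x ℕ.+ quot y) * binom (toℕ j)
        (rem y)) (sym (position y))
        (lucas n (toℕ j) (x ℕ.+ quot y) (rem y) (Fin.toℕ<n j) (ℕ.m%n<n _ p))
      visible : ∀ y → y ℕ.< m → skip r j ℕ.≤ quot y →
        at (window (parentLength m r j) n (x ℕ.+ skip r j)) (quot y ℕ.∸ skip r j)
          ≋ binom n (x ℕ.+ quot y)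
      visible y y<m s≤q = ≋-trans (at-block _ (ℕ.∸-monoˡ-< (s≤s (ℕ./-monoˡ-≤ p bound)) s≤q))
        (≋-reflexive (cong (binom n) (trans (ℕ.+-assoc x _ _) (cong (x ℕ.+_) (ℕ.m+[n∸m]≡n s≤q)))))
        where
        bound : suc (toℕ r) ℕ.+ y ℕ.≤ toℕ r ℕ.+ m
        bound = subst (ℕ._≤ toℕ r ℕ.+ m) (ℕ.+-suc (toℕ r) y) (ℕ.+-monoʳ-≤ (toℕ r) y<m)
      parent : ∀ y → y ℕ.< m →
        at (window (parentLength m r j) n (x ℕ.+ skip r j)) (quot y ℕ.∸ skip r j) * binom (toℕ j)
          (rem y)
        ≋ binom n (x ℕ.+ quot y) * binom (toℕ j) (rem y)
      parent y y<m with ℕ.≤-total (skip r j) (quot y) | skip-cases r j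
      ... | inj₁ s≤q | _ = *-cong (visible y y<m s≤q) ≋-refl
      ... | inj₂ q≤s | inj₁ (_ , s≡0) = *-cong (visible y y<m (ℕ.≤-trans (ℕ.≤-reflexive s≡0) z≤n))
            ≋-refl
      ... | inj₂ q≤s | inj₂ (j≤r , s≡1) with ℕ.m≤n⇒m<n∨m≡n q≤s
      ...   | inj₂ q≡s = *-cong (visible y y<m (ℕ.≤-reflexive (sym q≡s))) ≋-refl
      -- Here the truncated subtraction in `expand` points to entry 0 of the parent, which belongs
      -- to another period. This is harmless: the offset r + 1 + y exceeds j, so the binomial factor
      -- is 0.
      ...   | inj₁ q<s =
            ≋-reflexive (trans
              (vanish (at (window (parentLength m r j) n (x ℕ.+ skip r j)) (quot y ℕ.∸ skip r j)))
                (sym (vanish (binom n (x ℕ.+ quot y)))))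
        where
        rem≡ : rem y ≡ suc (toℕ r) ℕ.+ y
        rem≡ = ℕ.m<n⇒m%n≡m (ℕ.m/n≡0⇒m<n (ℕ.n<1⇒n≡0 (subst (quot y ℕ.<_) s≡1 q<s)))
        vanish : ∀ a → a * binom (toℕ j) (rem y) ≡ 0ℤ
        vanish a = trans (cong (a *_)
          (binom-above (subst (toℕ j ℕ.<_) (sym rem≡) (s≤s (ℕ.≤-trans j≤r (ℕ.m≤m+n _ y))))))
            (ℤ.*-zeroʳ a)

    -- This makes `expand` injective, since entry t can be recovered by dividing by the binomial
    -- factor at y. If the period of entry t starts inside the window, its first place has factor
    -- C(j,0) = 1. Otherwise t is the first entry and no period is skipped, so r < j, and the first
    -- place of the window has the nonzero factor C(j,r + 1).
    visible-entry : ∀ {m} r j → 1 ℕ.≤ m → ∀ t → t ℕ.< parentLength m r j → ∃ λ y →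
      y ℕ.< m × ((suc (toℕ r) ℕ.+ y) ℕ./ p ℕ.∸ skip r j ≡ t) × ¬ binom (toℕ j)
        ((suc (toℕ r) ℕ.+ y) ℕ.% p) ≋ 0ℤ
    visible-entry {m} r j 1≤m t t<len with t ℕ.+ skip r j in eq
    ... | suc k = y , y<m ,
      trans (cong (λ z → z ℕ./ p ℕ.∸ skip r j) position)
        (trans (cong (ℕ._∸ skip r j) (n/p (suc k) 0<p))
        (trans (cong (ℕ._∸ skip r j) (sym eq)) (ℕ.m+n∸n≡m t (skip r j)))) ,
      λ b≋0 → 1≉0 (subst (λ l → binom (toℕ j) l ≋ 0ℤ)
        (trans (cong (ℕ._% p) position) (n%p (suc k) 0<p)) b≋0)
      where
      y = p ℕ.* suc k ℕ.∸ suc (toℕ r)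
      r<pk : suc (toℕ r) ℕ.≤ p ℕ.* suc k
      r<pk = ℕ.≤-trans (Fin.toℕ<n r) (ℕ.m≤m*n p (suc k))
      position : suc (toℕ r) ℕ.+ y ≡ p ℕ.* suc k ℕ.+ 0
      position = trans (ℕ.m+[n∸m]≡n r<pk) (sym (ℕ.+-identityʳ _))
      k<quot : suc k ℕ.≤ (toℕ r ℕ.+ m) ℕ./ p
      k<quot = ℕ.s≤s⁻¹ (subst (λ s → s ℕ.< suc ((toℕ r ℕ.+ m) ℕ./ p)) eq
        (ℕ.m≤o∸n⇒m+n≤o (suc t) (ℕ.≤-trans (skip≤1 r j) (s≤s z≤n)) t<len))
      y<m : y ℕ.< m
      y<m = ℕ.+-cancelˡ-< (toℕ r) y m (begin
        suc (toℕ r) ℕ.+ y             ≡⟨ ℕ.m+[n∸m]≡n r<pk ⟩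
        p ℕ.* suc k                   ≤⟨ ℕ.*-monoʳ-≤ p k<quot ⟩
        p ℕ.* ((toℕ r ℕ.+ m) ℕ./ p)   ≤⟨ ℕ.≤-reflexive (ℕ.*-comm p _) ⟩
        (toℕ r ℕ.+ m) ℕ./ p ℕ.* p     ≤⟨ ℕ.m/n*n≤m _ p ⟩
        toℕ r ℕ.+ m ∎)
        where open ℕ.≤-Reasoning
    ... | zero with skip-cases r j
    ...   | inj₂ (_ , s≡1) = contradiction (trans (sym s≡1) (ℕ.m+n≡0⇒n≡0 t eq)) λ ()
    ...   | inj₁ (r<j , _) = 0 , 1≤m ,
      trans (cong (ℕ._∸ skip r j) (ℕ.m<n⇒m/n≡0 z<p))
        (trans (ℕ.0∸n≡0 (skip r j)) (sym (ℕ.m+n≡0⇒m≡0 t eq))) ,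
      λ b≋0 → binom-nonzero (Fin.toℕ<n j) (suc (toℕ r)) r<j
        (subst (λ l → binom (toℕ j) l ≋ 0ℤ) (trans (ℕ.m<n⇒m%n≡m z<p) (ℕ.+-identityʳ _)) b≋0)
      where
      z<p : suc (toℕ r) ℕ.+ 0 ℕ.< p
      z<p = subst (ℕ._< p) (sym (ℕ.+-identityʳ _)) (ℕ.≤-<-trans r<j (Fin.toℕ<n j))

    expand-injective : ∀ {m} r j → 1 ℕ.≤ m → ∀ {v v′} → expand {m} r j v ≡ expand r j v′ → v ≡ v′
    expand-injective {m} r j 1≤m {v} {v′} e = trans (≡block v pointwise) (block-at v′)
      where
      pointwise : ∀ t → t ℕ.< parentLength m r j → at v t ≋ at v′ t
      pointwise t t<len with y , y<m , refl , b≉0 ← visible-entry {m} r j 1≤m t t<len =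
        *-cancelˡ isPrime b b≉0 (subst₂ _≋_ (ℤ.*-comm (at v t) b) (ℤ.*-comm (at v′ t) b)
          (block-injective e y<m))
        where b = binom (toℕ j) ((suc (toℕ r) ℕ.+ y) ℕ.% p)

    expand-enumerates : ∀ {m} r j → 1 ℕ.≤ m → ∀ {L} → Enumerates L (Acc {parentLength m r j}) →
                        Enumerates (List.map (expand r j) L) (OccursAt {m} r j)
    expand-enumerates {m} r j 1≤m {L} (unique , ∈L⇔) = Unique.map⁺ (expand-injective r j 1≤m) unique
      , λ w → mk⇔ to from
      where
      to : ∀ {w} → w ∈ List.map (expand r j) L → OccursAt r j w
      -- Padding moves the parent window to a positive position, so that `skip` can be subtracted
      -- from it to obtain the period number x of the child.
      to w∈ with v , v∈L , refl ← ∈-map⁻ (expand r j) w∈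
            with n , x , refl ← accessible⇒window (Equivalence.to (∈L⇔ v) v∈L)
            with a , b , _ , e ← padded-window n x (parentLength m r j) =
        p ℕ.* a ℕ.+ n , p ℕ.* suc b ℕ.+ x ℕ.∸ skip r j ,
        trans (cong (expand r j)
          (sym (subst (λ z → window (parentLength m r j) (p ℕ.* a ℕ.+ n) z ≡ window _ n x)
            (sym (ℕ.m∸n+n≡m skip≤)) e)))
          (expand-window m r j (p ℕ.* a ℕ.+ n) (p ℕ.* suc b ℕ.+ x ℕ.∸ skip r j))
        where
        skip≤ : skip r j ℕ.≤ p ℕ.* suc b ℕ.+ x
        skip≤ = ℕ.≤-trans (skip≤1 r j) (ℕ.≤-trans 0<p (ℕ.≤-trans (ℕ.m≤m*n p (suc b)) (ℕ.m≤m+n _ x)))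
      from : ∀ {w} → OccursAt r j w → w ∈ List.map (expand r j) L
      from (n , x , refl) = subst (_∈ List.map (expand r j) L) (expand-window m r j n x)
        (∈-map⁺ (expand r j)
          (Equivalence.from (∈L⇔ _) (window-accessible (parentLength m r j) n (x ℕ.+ skip r j))))

    occursAt⇒accessible : ∀ {m r j} {w : Block m} → OccursAt r j w → Acc w
    occursAt⇒accessible {m} {r} {j} (n , x , refl) = window-accessible m (p ℕ.* n ℕ.+ toℕ j)
      (p ℕ.* x ℕ.+ suc (toℕ r))

    residue : ℕ → Fin p
    residue n = fromℕ< (ℕ.m%n<n n p)

    divMod′ : ∀ n → p ℕ.* (n ℕ./ p) ℕ.+ toℕ (residue n) ≡ n
    divMod′ n = trans (cong (p ℕ.* (n ℕ./ p) ℕ.+_) (Fin.toℕ-fromℕ< _)) (sym (divMod n))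

    -- The padding excludes x = 0, which for r = p - 1 is ≡ r + 1 but not of the form px′ + r + 1.
    window-occursAt : ∀ m n x → OccursAt (residue (q ℕ.+ x)) (residue n) (window m n x)
    window-occursAt m n x with a , b , _ , e ← padded-window n x m =
      a ℕ.+ n ℕ./ p , b ℕ.+ (q ℕ.+ x) ℕ./ p , trans (sym e) (cong₂ (window m) rowIndex position)
      where
      regroup : ∀ s t → p ℕ.* s ℕ.+ t ≡ p ℕ.* (s ℕ.+ t ℕ./ p) ℕ.+ toℕ (residue t)
      regroup s t = trans (cong (p ℕ.* s ℕ.+_) (sym (divMod′ t)))
        (trans (sym (ℕ.+-assoc (p ℕ.* s) _ _))
        (cong (ℕ._+ toℕ (residue t)) (sym (ℕ.*-distribˡ-+ p s (t ℕ./ p)))))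
      rowIndex : p ℕ.* a ℕ.+ n ≡ p ℕ.* (a ℕ.+ n ℕ./ p) ℕ.+ toℕ (residue n)
      rowIndex = regroup a n
      position : p ℕ.* suc b ℕ.+ x ≡ p ℕ.* (b ℕ.+ (q ℕ.+ x) ℕ./ p) ℕ.+ suc (toℕ (residue (q ℕ.+ x)))
      position = trans (cong (ℕ._+ x) (p*suc b))
        (trans (cong suc (trans (ℕ.+-assoc (p ℕ.* b) q x) (regroup b (q ℕ.+ x))))
        (sym (ℕ.+-suc _ _)))

    -- Special blocks

    occursAt⇒satisfies : ∀ {m r j} {w : Block m} → OccursAt r j w →
      Satisfies m (at w) (+ suc (toℕ r)) (val j)
    occursAt⇒satisfies {m} {r} {j} (n , x , refl) y h =
      transport {n = + N} {val j} {+ (X ℕ.+ y)} {+ (suc (toℕ r) ℕ.+ y)} {binom N (X ℕ.+ y)}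
        {binom N (suc (X ℕ.+ y))}
        (p*x+l≋l n (toℕ j))
        (subst (_≋ + (suc (toℕ r) ℕ.+ y)) (cong +_ (sym (ℕ.+-assoc (p ℕ.* x) _ y)))
          (p*x+l≋l x (suc (toℕ r) ℕ.+ y)))
        (≋-sym (at-block _ (ℕ.<-trans (ℕ.n<1+n y) h)))
        (≋-sym (≋-trans (at-block _ h) (≋-reflexive (cong (binom N) (ℕ.+-suc X y)))))
        (binom-rec N (X ℕ.+ y))
      where
      N = p ℕ.* n ℕ.+ toℕ j
      X = p ℕ.* x ℕ.+ suc (toℕ r)
      transport : ∀ {n n′ z z′ a b a′ b′} → n ≋ n′ → z ≋ z′ → a ≋ a′ → b ≋ b′ →
                  (1ℤ + z) * b + z * a ≡ n * a → (1ℤ + z′) * b′ + z′ * a′ ≋ n′ * a′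
      transport {z = z} {z′} {a} {b} {a′} {b′} en ez ea eb e =
        ≋-trans (≋-sym (+-cong (*-cong (+-cong (≋-refl {1ℤ}) ez) eb) (*-cong ez ea)))
          (≋-trans (≋-reflexive e) (*-cong en ea))

    val-residue : ∀ n → val (residue n) ≋ + n
    val-residue n = val-red (+ n)

    1+q≋0 : + suc q ≋ 0ℤ
    1+q≋0 = subst (λ n → + n ≋ 0ℤ) (sym 1+q≡p) p≋0

    window-occursAt′ : ∀ m {n x r j} → + n ≋ val j → + x ≋ + suc (toℕ r) →
      OccursAt r j (window m n x)
    window-occursAt′ m {n} {x} {r} {j} en ex =
      subst₂ (λ r j → OccursAt r j (window m n x)) (val-injective position)
        (val-injective (≋-trans (val-residue n) en))
        (window-occursAt m n x)
      where
      -- q + x plays the role of x - 1, since 1 + q = p.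
      position : val (residue (q ℕ.+ x)) ≋ val r
      position = ≋-trans (val-residue (q ℕ.+ x))
        (linear₂ 1ℤ 1ℤ (identity (+ q) (+ x) (val r)) ex 1+q≋0)
        where
        identity : ∀ q x r → q + x - r ≡ 1ℤ * (x - (1ℤ + r)) + 1ℤ * ((1ℤ + q) - 0ℤ)
        identity = solve-∀

    -- The scaled copy is shifted by multiples of p in both row number and position, so scaling by c
    -- keeps the pair (r, j).
    scaled-occursAt : ∀ m {n x r j} c → + n ≋ val j → + x ≋ + suc (toℕ r) →
                      OccursAt r j (block m (λ y → + c * binom n (x ℕ.+ y)))
    scaled-occursAt m {n} {x} {r} {j} c en ex with u , v , _ , e ← scaled-window n x m c =
      subst (OccursAt r j) e (window-occursAt′ m (≋-trans (p*x+l≋l u n) en)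
        (≋-trans (p*x+l≋l (suc v) x) ex))

    scaled-occursAt′ : ∀ m {n x r j} {f : ℕ → ℤ} (c : Fin p) → + n ≋ val j → + x ≋ + suc (toℕ r) →
      (∀ y → y ℕ.< m → binom n (x ℕ.+ y) ≋ f y) → OccursAt r j (block m (λ y → val c * f y))
    scaled-occursAt′ m {n} {x} {r} {j} {f} c en ex e = subst (OccursAt r j)
      (block-cong {m} {λ y → val c * binom n (x ℕ.+ y)} {λ y → val c * f y}
        (λ y h → *-congˡ (val c) (e y h))) (scaled-occursAt m (toℕ c) en ex)

    zero-occursAt : ∀ m r j → OccursAt r j (block m (λ _ → 0ℤ))
    zero-occursAt m r j = scaled-occursAt m {toℕ j} {suc (toℕ r)} 0 ≋-refl ≋-refl

    -- The window begins at the last entry C(j,j) = 1 of row j, runs past its end, and is scaled by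
    -- c.
    start-occursAt : ∀ m {r j} (c : Fin p) → val j ≋ + suc (toℕ r) →
      OccursAt r j (block m (atStart (val c)))
    start-occursAt m {r} {j} c e =
      subst (OccursAt r j) (block-cong {m} {λ y → val c * atStart 1ℤ y} {atStart (val c)} scaled)
      (scaled-occursAt′ m {n = toℕ j} {toℕ j} {f = atStart 1ℤ} c ≋-refl e
        (λ y _ → ≋-reflexive (entries y)))
      where
      entries : ∀ y → binom (toℕ j) (toℕ j ℕ.+ y) ≡ atStart 1ℤ y
      entries zero    = trans (cong (binom (toℕ j)) (ℕ.+-identityʳ (toℕ j))) (binom-diag (toℕ j))
      entries (suc y) = binom-above (ℕ.m<m+n (toℕ j) z<s)
      scaled : ∀ y → y ℕ.< m → val c * atStart 1ℤ y ≋ atStart (val c) y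
      scaled zero    _ = ≋-reflexive (ℤ.*-identityʳ (val c))
      scaled (suc y) _ = ≋-reflexive (ℤ.*-zeroʳ (val c))

    -- In row P + j, with P a large power of p, Lucas gives zeros at the positions strictly between
    -- j and P, and 1 at P. The window of length l + 1 ending at P begins at P - l, hence the
    -- condition r + 1 + l ≡ 0.
    end-occursAt : ∀ l {r j} (c : Fin p) → + suc (toℕ r) + + l ≋ 0ℤ →
      OccursAt r j (block (suc l) (atEnd l (val c)))
    end-occursAt l {r} {j} c e with P′ , big , lucasP ← lucas-large (toℕ j ℕ.+ l) =
      subst (OccursAt r j) (block-cong {suc l} {λ y → val c * atEnd l 1ℤ y} {atEnd l (val c)} λ y _
        → ≋-reflexive (scaled l y))
        (scaled-occursAt′ (suc l) {n = P ℕ.* 1 ℕ.+ toℕ j} {P ℕ.∸ l} {f = atEnd l 1ℤ} c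
          (≋-trans (≋-reflexive (cong (λ z → + (z ℕ.+ toℕ j)) (ℕ.*-identityʳ P)))
            (p*x+l≋l P′ (toℕ j)))
          position entries)
      where
      P = p ℕ.* P′
      j+l<P : toℕ j ℕ.+ l ℕ.< P
      j+l<P = ℕ.<-≤-trans big (ℕ.m≤n*m P′ p)
      l≤P : l ℕ.≤ P
      l≤P = ℕ.≤-trans (ℕ.m≤n+m l (toℕ j)) (ℕ.<⇒≤ j+l<P)
      position : + (P ℕ.∸ l) ≋ + suc (toℕ r)
      position = linear₂ 1ℤ -1ℤ (identity (+ (P ℕ.∸ l)) (+ l) (+ suc (toℕ r)))
        (≋-trans (≋-reflexive (cong +_ (ℕ.m∸n+n≡m l≤P))) (p*≋0 P′)) e
        where
        identity : ∀ x l s → x - s ≡ 1ℤ * ((x + l) - 0ℤ) + -1ℤ * ((s + l) - 0ℤ)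
        identity = solve-∀
      scaled : ∀ l y → val c * atEnd l 1ℤ y ≡ atEnd l (val c) y
      scaled zero    zero    = ℤ.*-identityʳ (val c)
      scaled zero    (suc y) = ℤ.*-zeroʳ (val c)
      scaled (suc l) zero    = ℤ.*-zeroʳ (val c)
      scaled (suc l) (suc y) = scaled l y
      entries : ∀ y → y ℕ.< suc l → binom (P ℕ.* 1 ℕ.+ toℕ j) (P ℕ.∸ l ℕ.+ y) ≋ atEnd l 1ℤ y
      entries y (s≤s y≤l) with ℕ.m≤n⇒m<n∨m≡n y≤l
      ... | inj₂ refl = ≋-trans (≋-reflexive (cong (binom (P ℕ.* 1 ℕ.+ toℕ j))
              (trans (ℕ.m∸n+n≡m l≤P) (sym (trans (ℕ.+-identityʳ _) (ℕ.*-identityʳ P))))))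
            (≋-trans (lucasP 1 (toℕ j) 1 0 (ℕ.≤-<-trans (ℕ.m≤m+n _ l) j+l<P)
              (ℕ.≤-<-trans z≤n j+l<P))
              (≋-reflexive (sym (atEnd-last l 1ℤ))))
      ... | inj₁ y<l =
            ≋-trans (≋-reflexive (cong (λ s → binom (P ℕ.* 1 ℕ.+ toℕ j) (s ℕ.+ z))
              (sym (ℕ.*-zeroʳ P))))
            (≋-trans (lucasP 1 (toℕ j) 0 z (ℕ.≤-<-trans (ℕ.m≤m+n _ l) j+l<P) z<P)
              (≋-reflexive (trans (cong (1ℤ *_) (binom-above j<z)) (sym (atEnd-before 1ℤ y<l)))))
        where
        z = P ℕ.∸ l ℕ.+ y
        z<P : z ℕ.< P
        z<P = subst (z ℕ.<_) (ℕ.m∸n+n≡m l≤P) (ℕ.+-monoʳ-< (P ℕ.∸ l) y<l)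
        j<z : toℕ j ℕ.< z
        j<z = ℕ.<-≤-trans (ℕ.m+n≤o⇒m≤o∸n (suc (toℕ j)) j+l<P) (ℕ.m≤m+n _ y)

    -- Row P - 1, with P a large power of p, is 1, -1, 1, ... modulo p: neighbouring entries add up
    -- to an entry of row P strictly between its ends, which vanishes by Lucas.
    alternating-occursAt : ∀ m {r j} (c : Fin p) → val j ≋ -1ℤ →
      OccursAt r j (block m (alternating (val c)))
    alternating-occursAt m {r} {j} c e with P′ , big , lucasP ← lucas-large (suc (toℕ r) ℕ.+ m) =
      subst (OccursAt r j) (block-cong {m} {λ y → val c′ * alternating 1ℤ (x ℕ.+ y)}
        {alternating (val c)} λ y _ → scaled y)
        (scaled-occursAt′ m {n = N} {x} {f = λ y → alternating 1ℤ (x ℕ.+ y)} c′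
          (≋-trans rowIndex (≋-sym e)) ≋-refl
          (λ y y<m → entries (x ℕ.+ y) (ℕ.<-trans (ℕ.+-monoʳ-< x y<m) x+m<P)))
      where
      P = p ℕ.* P′
      N = ℕ.pred P
      x = suc (toℕ r)
      -- The row has sign (-1)^x at position x; multiplying c by the same sign makes the block begin
      -- with c.
      c′ = red (val c * alternating 1ℤ x)
      x+m<P : x ℕ.+ m ℕ.< P
      x+m<P = ℕ.<-≤-trans big (ℕ.m≤n*m P′ p)
      1+N≡P : suc N ≡ P
      1+N≡P = ℕ.suc-pred P {{ℕ.>-nonZero (ℕ.≤-<-trans z≤n x+m<P)}}
      rowIndex : + N ≋ -1ℤ
      rowIndex = linear₁ 1ℤ (identity (+ N)) (≋-trans (≋-reflexive (cong +_ 1+N≡P)) (p*≋0 P′))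
        where
        identity : ∀ n → n - -1ℤ ≡ 1ℤ * ((1ℤ + n) - 0ℤ)
        identity = solve-∀
      entries : ∀ z → z ℕ.< P → binom N z ≋ alternating 1ℤ z
      entries zero    _ = ≋-refl
      entries (suc z) h = linear₂ 1ℤ -1ℤ (identity (binom N z) (binom N (suc z)) (alternating 1ℤ z))
        (≋-trans (≋-reflexive
          (cong₂ binom (trans 1+N≡P (sym (trans (ℕ.+-identityʳ _) (ℕ.*-identityʳ P))))
                                           (cong (ℕ._+ suc z) (sym (ℕ.*-zeroʳ P)))))
          (lucasP 1 0 0 (suc z) (ℕ.≤-<-trans z≤n h) h))
        (entries z (ℕ.<-trans (ℕ.n<1+n z) h))
        where
        identity : ∀ a b c → b - - c ≡ 1ℤ * ((a + b) - 0ℤ) + -1ℤ * (a - c)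
        identity = solve-∀
      scaled : ∀ y → val c′ * alternating 1ℤ (x ℕ.+ y) ≋ alternating (val c) y
      scaled y = ≋-trans (*-cong (val-red (val c * alternating 1ℤ x))
        (≋-refl {alternating 1ℤ (x ℕ.+ y)}))
        (≋-reflexive (trans (alternating-shift (val c * alternating 1ℤ x) x y)
          (cong (λ s → alternating s y) (trans (ℤ.*-assoc (val c) _ _)
            (trans (cong (val c *_) (alternating-1² x)) (ℤ.*-identityʳ (val c)))))))

    unit : Fin q → Fin p
    unit k = fromℕ< (subst (suc (toℕ k) ℕ.<_) 1+q≡p (s<s (Fin.toℕ<n k)))

    val-unit : ∀ k → val (unit k) ≡ + suc (toℕ k)
    val-unit k = cong +_ (Fin.toℕ-fromℕ< _)

    unit≉0 : ∀ k → ¬ val (unit k) ≋ 0ℤ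
    unit≉0 k = small≉0 (subst (0 ℕ.<_) (sym (ℤ.+-injective (val-unit k))) z<s) (Fin.toℕ<n (unit k))

    unit-injective : ∀ {k k′} → val (unit k) ≋ val (unit k′) → k ≡ k′
    unit-injective {k} {k′} e = Fin.toℕ-injective (ℕ.suc-injective (ℤ.+-injective
      (trans (sym (val-unit k)) (trans (cong val (val-injective e)) (val-unit k′)))))

    unit-complete : ∀ a → ¬ a ≋ 0ℤ → ∃ λ k → a ≋ val (unit k)
    unit-complete a a≉0 with toℕ (red a) in eq
    ... | zero  = contradiction (≋-trans (≋-sym (val-red a)) (≋-reflexive (cong +_ eq))) a≉0
    ... | suc t = fromℕ< t<q , ≋-trans (≋-sym (val-red a))
      (≋-reflexive (trans (cong +_ (trans eq (cong suc (sym (Fin.toℕ-fromℕ< t<q)))))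
        (sym (val-unit (fromℕ< t<q)))))
      where
      t<q : t ℕ.< q
      t<q = ℕ.s<s⁻¹ (subst₂ ℕ._<_ eq (sym 1+q≡p) (Fin.toℕ<n (red a)))

    indices : List (Fin p × Fin p)
    indices = cartesianProduct (allFin p) (allFin p)

    unique-indices : Unique indices
    unique-indices = Unique.cartesianProduct⁺ (Unique.allFin⁺ p) (Unique.allFin⁺ p)

    ∈-indices : ∀ i → i ∈ indices
    ∈-indices (r , j) = ∈-cartesianProduct⁺ (∈-allFin r) (∈-allFin j)

    Occurs : ∀ {m} → Fin p × Fin p → Block m → Set
    Occurs (r , j) w = OccursAt r j w

    -- Special blocks of length l + 1 ≥ 3 and the pairs at which they occur

    module _ (l : ℕ) (2≤l : 2 ℕ.≤ l) where

      private
        m = suc l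

        0<l : 0 ℕ.< l
        0<l = ℕ.≤-trans (ℕ.n≤1+n 1) 2≤l

      zeros : ℕ → ℤ
      zeros _ = 0ℤ

      starting ending alternate : Fin q → ℕ → ℤ
      starting  k = atStart (val (unit k))
      ending    k = atEnd l (val (unit k))
      alternate k = alternating (val (unit k))

      zeroBlock : Block m
      zeroBlock = block m zeros

      startBlock endBlock alternatingBlock : Fin q → Block m
      startBlock       k = block m (starting k)
      endBlock         k = block m (ending k)
      alternatingBlock k = block m (alternate k)

      startBlocks endBlocks alternatingBlocks special : List (Block m)
      startBlocks       = map startBlock (allFin q)
      endBlocks         = map endBlock (allFin q)
      alternatingBlocks = map alternatingBlock (allFin q)
      special = zeroBlock ∷ startBlocks ++ endBlocks ++ alternatingBlocks

      data IsSpecial : Block m → Set where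
        isZero        : IsSpecial zeroBlock
        isStart       : ∀ k → IsSpecial (startBlock k)
        isEnd         : ∀ k → IsSpecial (endBlock k)
        isAlternating : ∀ k → IsSpecial (alternatingBlock k)

      ∈-special⁻ : ∀ {w} → w ∈ special → IsSpecial w
      ∈-special⁻ (here refl) = isZero
      ∈-special⁻ (there w∈) with ∈-++⁻ startBlocks w∈
      ... | inj₁ w∈s with k , _ , refl ← ∈-map⁻ startBlock w∈s = isStart k
      ... | inj₂ w∈r with ∈-++⁻ endBlocks w∈r
      ...   | inj₁ w∈e with k , _ , refl ← ∈-map⁻ endBlock w∈e = isEnd k
      ...   | inj₂ w∈a with k , _ , refl ← ∈-map⁻ alternatingBlock w∈a = isAlternating k

      ∈-special⁺ : ∀ {w} → IsSpecial w → w ∈ special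
      ∈-special⁺ isZero            = here refl
      ∈-special⁺ (isStart k)       = there (∈-++⁺ˡ (∈-map⁺ startBlock (∈-allFin k)))
      ∈-special⁺ (isEnd k)         =
        there (∈-++⁺ʳ startBlocks (∈-++⁺ˡ (∈-map⁺ endBlock (∈-allFin k))))
      ∈-special⁺ (isAlternating k) =
        there (∈-++⁺ʳ startBlocks (∈-++⁺ʳ endBlocks (∈-map⁺ alternatingBlock (∈-allFin k))))

      entry : ∀ f g → block m f ≡ block m g → ∀ {y} → y ℕ.< m → f y ≋ g y
      entry f g = block-injective {m} {f} {g}

      atEnd-0 : ∀ k → atEnd l (val (unit k)) 0 ≡ 0ℤ
      atEnd-0 k = atEnd-before (val (unit k)) 0<l

      unique-special : Unique special
      unique-special = All.tabulate zero≢ ∷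
        Unique.++⁺ (Unique.map⁺ start-injective (Unique.allFin⁺ q))
          (Unique.++⁺ (Unique.map⁺ end-injective (Unique.allFin⁺ q))
            (Unique.map⁺ alternating-injective (Unique.allFin⁺ q)) end#alternating)
          start#rest
        where
        start-injective : ∀ {k k′} → startBlock k ≡ startBlock k′ → k ≡ k′
        start-injective {k} {k′} e = unit-injective (entry (starting k) (starting k′) e z<s)
        alternating-injective : ∀ {k k′} → alternatingBlock k ≡ alternatingBlock k′ → k ≡ k′
        alternating-injective {k} {k′} e = unit-injective (entry (alternate k) (alternate k′) e z<s)
        end-injective : ∀ {k k′} → endBlock k ≡ endBlock k′ → k ≡ k′
        end-injective {k} {k′} e =
          unit-injective (subst₂ _≋_ (atEnd-last l (val (unit k))) (atEnd-last l (val (unit k′)))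
            (entry (ending k) (ending k′) e (ℕ.n<1+n l)))
        end#alternating : ∀ {w} → ¬ (w ∈ endBlocks × w ∈ alternatingBlocks)
        end#alternating (w∈e , w∈a) with k , _ , refl ← ∈-map⁻ endBlock w∈e with k′ , _ , e ← ∈-map⁻
          alternatingBlock w∈a =
          unit≉0 k′ (≋-trans (≋-sym (entry (ending k) (alternate k′) e z<s))
            (≋-reflexive (atEnd-0 k)))
        start#rest : ∀ {w} → ¬ (w ∈ startBlocks × w ∈ endBlocks ++ alternatingBlocks)
        start#rest (w∈s , w∈r) with k , _ , refl ← ∈-map⁻ startBlock w∈s with ∈-++⁻ endBlocks w∈r
        ... | inj₁ w∈e with k′ , _ , e ← ∈-map⁻ endBlock w∈e =
              unit≉0 k (≋-trans (entry (starting k) (ending k′) e z<s) (≋-reflexive (atEnd-0 k′)))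
        -- The entries at 0 may agree, so entry 1 decides: 0 against -c.
        ... | inj₂ w∈a with k′ , _ , e ← ∈-map⁻ alternatingBlock w∈a =
          unit≉0 k′ (subst₂ _≋_ (ℤ.neg-involutive (val (unit k′))) refl
            (-‿cong {b = 0ℤ} (≋-sym (entry (starting k) (alternate k′) e (s<s 0<l)))))
        zero≢ : ∀ {w} → w ∈ startBlocks ++ endBlocks ++ alternatingBlocks → zeroBlock ≢ w
        zero≢ w∈ e with ∈-++⁻ startBlocks w∈
        ... | inj₁ w∈s with k , _ , refl ← ∈-map⁻ startBlock w∈s =
              unit≉0 k (≋-sym (entry zeros (starting k) e z<s))
        ... | inj₂ w∈r with ∈-++⁻ endBlocks w∈r
        ...   | inj₁ w∈e with k , _ , refl ← ∈-map⁻ endBlock w∈e =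
              unit≉0 k (subst (_≋ 0ℤ) (atEnd-last l (val (unit k)))
                (≋-sym (entry zeros (ending k) e (ℕ.n<1+n l))))
        ...   | inj₂ w∈a with k , _ , refl ← ∈-map⁻ alternatingBlock w∈a =
              unit≉0 k (≋-sym (entry zeros (alternate k) e z<s))

      vanishing⇒special : ∀ {w : Block m} → (∀ y → y ℕ.< m → at w y ≋ 0ℤ) → IsSpecial w
      vanishing⇒special {w} h = subst IsSpecial (sym (≡block {f = zeros} w h)) isZero

      -- Each degenerate outcome of `two-recurrences` leaves one entry free, the last or the first,
      -- which determines the block. If it vanishes, so does the block; otherwise it is the c of one
      -- of the three families.
      separated : ∀ {i i′} {w : Block m} → Occurs i w → Occurs i′ w → i ≡ i′ ⊎ w ∈ special
      separated {r , j} {r′ , j′} {w} occ occ′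
        with two-recurrences {m} {at w} {+ suc (toℕ r)} {val j} {+ suc (toℕ r′)} {val j′} (s≤s 2≤l)
          (occursAt⇒satisfies occ) (occursAt⇒satisfies occ′)
      ... | inj₁ (α≋α′ , j≋j′) =
            inj₁ (cong₂ _,_ (val-injective (linear₁ 1ℤ (identity (val r) (val r′)) α≋α′))
              (val-injective j≋j′))
        where
        identity : ∀ r r′ → r - r′ ≡ 1ℤ * ((1ℤ + r) - (1ℤ + r′))
        identity = solve-∀
      ... | inj₂ (inj₁ h) = inj₂ (∈-special⁺ (end (at w l ≋? 0ℤ)))
        where
        end : Dec (at w l ≋ 0ℤ) → IsSpecial w
        end (yes e) = vanishing⇒special λ y y<m → [ (λ y<l → h y (s<s y<l)) , (λ { refl → e }) ]′
          (ℕ.m≤n⇒m<n∨m≡n (ℕ.s≤s⁻¹ y<m))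
        end (no ne) with k , e ← unit-complete _ ne =
          subst IsSpecial (sym (≡block {f = ending k} w λ y y<m →
          [ (λ y<l → ≋-trans (h y (s<s y<l)) (≋-reflexive (sym (atEnd-before _ y<l))))
          , (λ { refl → ≋-trans e (≋-reflexive (sym (atEnd-last l _))) }) ]′
            (ℕ.m≤n⇒m<n∨m≡n (ℕ.s≤s⁻¹ y<m)))) (isEnd k)
      ... | inj₂ (inj₂ (inj₁ h)) = inj₂ (∈-special⁺ (start (at w 0 ≋? 0ℤ)))
        where
        start : Dec (at w 0 ≋ 0ℤ) → IsSpecial w
        start (yes e) = vanishing⇒special λ { zero _ → e ; (suc y) y<m → h y y<m }
        start (no ne) with k , e ← unit-complete _ ne =
          subst IsSpecial (sym (≡block {f = starting k} w λ { zero _ → e ; (suc y) y<m → h y y<m }))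
            (isStart k)
      ... | inj₂ (inj₂ (inj₂ h)) = inj₂ (∈-special⁺ (alt (at w 0 ≋? 0ℤ)))
        where
        propagate : ∀ {c} → at w 0 ≋ c → ∀ y → y ℕ.< m → at w y ≋ alternating c y
        propagate e zero    _   = e
        propagate e (suc y) y<m =
          ≋-trans (h y y<m) (-‿cong (propagate e y (ℕ.<-trans (ℕ.n<1+n y) y<m)))
        alternating-0 : ∀ y → alternating 0ℤ y ≡ 0ℤ
        alternating-0 zero    = refl
        alternating-0 (suc y) = cong -_ (alternating-0 y)
        alt : Dec (at w 0 ≋ 0ℤ) → IsSpecial w
        alt (yes e) = vanishing⇒special λ y y<m → ≋-trans (propagate e y y<m)
          (≋-reflexive (alternating-0 y))
        alt (no ne) with k , e ← unit-complete _ ne =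
          subst IsSpecial (sym (≡block {f = alternate k} w (propagate e))) (isAlternating k)

      zero-occurrences : Enumerates indices (λ i → Occurs i zeroBlock)
      zero-occurrences = unique-indices , λ i → mk⇔ (λ _ → zero-occursAt m (proj₁ i) (proj₂ i))
        (λ _ → ∈-indices i)

      startIndex : Fin p → Fin p × Fin p
      startIndex r = r , red (+ suc (toℕ r))

      -- The recurrence at y = 0 reads (r + 1) c ≡ j c and forces j ≡ r + 1, while r remains free.
      start-occurrences : ∀ k →
        Enumerates (map startIndex (allFin p)) (λ i → Occurs i (startBlock k))
      start-occurrences k = Unique.map⁺ (cong proj₁) (Unique.allFin⁺ p) , λ i → mk⇔ to from
        where
        to : ∀ {i} → i ∈ map startIndex (allFin p) → Occurs i (startBlock k)
        to i∈ with r , _ , refl ← ∈-map⁻ startIndex i∈ = start-occursAt m (unit k)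
          (val-red (+ suc (toℕ r)))
        from : ∀ {i} → Occurs i (startBlock k) → i ∈ map startIndex (allFin p)
        from {r , j} occ = subst (_∈ map startIndex (allFin p))
          (cong (r ,_) (val-injective (≋-trans (val-red _) α≋j)))
          (∈-map⁺ startIndex (∈-allFin r))
          where
          α = + suc (toℕ r)
          c = val (unit k)
          first : (1ℤ + (α + 0ℤ)) * 0ℤ + (α + 0ℤ) * c ≋ val j * c
          first = ≋-trans
            (≋-sym (+-cong (*-congˡ (1ℤ + (α + 0ℤ)) (at-block {m} {1} (atStart c) (s<s 0<l)))
                                         (*-congˡ (α + 0ℤ) (at-block {m} {0} (atStart c) z<s))))
                    (≋-trans (occursAt⇒satisfies occ 0 (s<s 0<l))
                      (*-congˡ (val j) (at-block {m} {0} (atStart c) z<s)))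
          α≋j : α ≋ val j
          α≋j = *-cancelˡ isPrime c (unit≉0 k) (linear₁ 1ℤ (identity α (val j) c) first)
            where
            identity : ∀ α j c →
              c * α - c * j ≡ 1ℤ * (((1ℤ + (α + 0ℤ)) * 0ℤ + (α + 0ℤ) * c) - j * c)
            identity = solve-∀

      endIndex : Fin p → Fin p × Fin p
      endIndex j = red (- + m) , j

      -- The step of the recurrence from position l - 1 to l reads (1 + (r + 1) + (l - 1)) c ≡ 0,
      -- that is r ≡ -m, while j remains free.
      end-occurrences : ∀ k → Enumerates (map endIndex (allFin p)) (λ i → Occurs i (endBlock k))
      end-occurrences k = Unique.map⁺ (cong proj₂) (Unique.allFin⁺ p) , λ i → mk⇔ to from
        where
        to : ∀ {i} → i ∈ map endIndex (allFin p) → Occurs i (endBlock k)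
        to i∈ with j , _ , refl ← ∈-map⁻ endIndex i∈ = end-occursAt l (unit k)
          (linear₁ 1ℤ (identity (val (red (- + m))) (+ l)) (val-red (- + m)))
          where
          identity : ∀ r l → (1ℤ + r) + l - 0ℤ ≡ 1ℤ * (r - - (1ℤ + l))
          identity = solve-∀
        from : ∀ {i} → Occurs i (endBlock k) → i ∈ map endIndex (allFin p)
        from {r , j} occ = subst (_∈ map endIndex (allFin p))
          (cong (_, j) (val-injective (≋-trans (val-red _) -m≋r)))
          (∈-map⁺ endIndex (∈-allFin j))
          where
          α = + suc (toℕ r)
          c = val (unit k)
          l′ = ℕ.pred l
          1+l′≡l : suc l′ ≡ l
          1+l′≡l = ℕ.suc-pred l {{ℕ.>-nonZero 0<l}}
          l′<l : l′ ℕ.< l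
          l′<l = ℕ.≤-reflexive 1+l′≡l
          entry-l′ : at (endBlock k) l′ ≋ 0ℤ
          entry-l′ = ≋-trans (at-block (atEnd l c) (ℕ.<-trans l′<l (ℕ.n<1+n l)))
            (≋-reflexive (atEnd-before c l′<l))
          entry-l : at (endBlock k) (suc l′) ≋ c
          entry-l = subst (λ y → at (endBlock k) y ≋ c) (sym 1+l′≡l)
            (≋-trans (at-block (atEnd l c) (ℕ.n<1+n l)) (≋-reflexive (atEnd-last l c)))
          last : (1ℤ + (α + + l′)) * c + (α + + l′) * 0ℤ ≋ val j * 0ℤ
          last = ≋-trans
            (≋-sym (+-cong (*-congˡ (1ℤ + (α + + l′)) entry-l) (*-congˡ (α + + l′) entry-l′)))
                   (≋-trans (occursAt⇒satisfies occ l′ (s≤s l′<l)) (*-congˡ (val j) entry-l′))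
          -m≋r : - + m ≋ val r
          -m≋r = linear₁ -1ℤ (trans (cong (λ t → - + suc t - val r) (sym 1+l′≡l))
            (identity′ (val r) (+ l′)))
            (*≋0⇒≋0ʳ isPrime c (unit≉0 k) (linear₁ 1ℤ (identity α (val j) c (+ l′)) last))
            where
            identity : ∀ α j c l′ →
              c * (1ℤ + (α + l′)) - 0ℤ ≡ 1ℤ * (((1ℤ + (α + l′)) * c + (α + l′) * 0ℤ) - j * 0ℤ)
            identity = solve-∀
            identity′ : ∀ r l′ → - (1ℤ + (1ℤ + l′)) - r ≡ -1ℤ * ((1ℤ + ((1ℤ + r) + l′)) - 0ℤ)
            identity′ = solve-∀

      alternatingIndex : Fin p → Fin p × Fin p
      alternatingIndex r = r , red -1ℤ

      -- At y = 0 the terms in α cancel and the recurrence reads -c ≡ j c. This forces j ≡ -1, while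
      -- r remains free.
      alternating-occurrences : ∀ k →
        Enumerates (map alternatingIndex (allFin p)) (λ i → Occurs i (alternatingBlock k))
      alternating-occurrences k = Unique.map⁺ (cong proj₁) (Unique.allFin⁺ p) , λ i → mk⇔ to from
        where
        to : ∀ {i} → i ∈ map alternatingIndex (allFin p) → Occurs i (alternatingBlock k)
        to i∈ with r , _ , refl ← ∈-map⁻ alternatingIndex i∈ = alternating-occursAt m (unit k)
          (val-red -1ℤ)
        from : ∀ {i} → Occurs i (alternatingBlock k) → i ∈ map alternatingIndex (allFin p)
        from {r , j} occ = subst (_∈ map alternatingIndex (allFin p))
          (cong (r ,_) (val-injective (≋-trans (val-red _) -1≋j)))
          (∈-map⁺ alternatingIndex (∈-allFin r))
          where
          α = + suc (toℕ r)
          c = val (unit k)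
          first : (1ℤ + (α + 0ℤ)) * - c + (α + 0ℤ) * c ≋ val j * c
          first = ≋-trans
            (≋-sym (+-cong (*-congˡ (1ℤ + (α + 0ℤ)) (at-block {m} {1} (alternating c) (s<s 0<l)))
                                         (*-congˡ (α + 0ℤ) (at-block {m} {0} (alternating c) z<s))))
                    (≋-trans (occursAt⇒satisfies occ 0 (s<s 0<l))
                      (*-congˡ (val j) (at-block {m} {0} (alternating c) z<s)))
          -1≋j : -1ℤ ≋ val j
          -1≋j = *-cancelˡ isPrime c (unit≉0 k) (linear₁ 1ℤ (identity α (val j) c) first)
            where
            identity : ∀ α j c →
              c * -1ℤ - c * j ≡ 1ℤ * (((1ℤ + (α + 0ℤ)) * - c + (α + 0ℤ) * c) - j * c)
            identity = solve-∀

      special-accessible : ∀ {w} → w ∈ special → Acc w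
      special-accessible w∈ with ∈-special⁻ w∈
      ... | isZero          = occursAt⇒accessible (zero-occursAt m (residue 0) (residue 0))
      ... | isStart k       =
            occursAt⇒accessible (Equivalence.to (proj₂ (start-occurrences k) _)
              (∈-map⁺ startIndex (∈-allFin (residue 0))))
      ... | isEnd k         =
            occursAt⇒accessible (Equivalence.to (proj₂ (end-occurrences k) _)
              (∈-map⁺ endIndex (∈-allFin (residue 0))))
      ... | isAlternating k =
            occursAt⇒accessible (Equivalence.to (proj₂ (alternating-occurrences k) _)
              (∈-map⁺ alternatingIndex (∈-allFin (residue 0))))

      -- Counting blocks of length m from their parents

      module _ (parents : ∀ i → ∃ (IsNumAccessible p onePlusX (parentLength m (proj₁ i) (proj₂ i)))) where

        pieces : Fin p × Fin p → List (Block m)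
        pieces i@(r , j) = map (expand r j) (proj₁ (proj₂ (parents i)))

        pieces-enumerate : ∀ i → Enumerates (pieces i) (Occurs i)
        pieces-enumerate i@(r , j) with _ , L , unique , _ , L⇔ ← parents i =
          expand-enumerates r j (s≤s z≤n) (unique , L⇔)

        length-pieces : ∀ i → length (pieces i) ≡ proj₁ (parents i)
        length-pieces i@(r , j) = trans (List.length-map (expand r j) (proj₁ (proj₂ (parents i))))
          (proj₁ (proj₂ (proj₂ (proj₂ (parents i)))))

        open Cover (Vec.≡-dec Fin._≟_) indices unique-indices ∈-indices pieces pieces-enumerate

        accessible-occurs : ∀ {w : Block m} → Acc w → ∃ λ i → Occurs i w
        accessible-occurs acc with n , x , refl ← accessible⇒window acc =
          (residue (q ℕ.+ x) , residue n) , window-occursAt m n x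

        ordinaryBlocks : List (Block m)
        ordinaryBlocks = ordinary {Q = Acc} occursAt⇒accessible accessible-occurs special
          unique-special special-accessible separated

        -- The sum over all pairs counts ordinary blocks once and special ones with multiplicity,
        -- whereas c counts every block once. Adding the number 1 + 3(p - 1) of special blocks on
        -- the left balances the two without subtraction.
        count : ∃ λ c → IsNumAccessible p onePlusX m c ×
          sum (map (proj₁ ∘ parents) indices) ℕ.+ suc (3 ℕ.* q) ≡ p ℕ.* p ℕ.+ 3 ℕ.* (q ℕ.* p) ℕ.+ c
        count = length (special ++ ordinaryBlocks) ,
          (special ++ ordinaryBlocks , proj₁ enumeration , refl , proj₂ enumeration) , total
          where
          enumeration : Enumerates (special ++ ordinaryBlocks) Acc
          enumeration = cover-enumerates occursAt⇒accessible accessible-occurs special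
            unique-special special-accessible separated

          family : (B : Fin q → Block m) → (∀ k → multiplicity (B k) ≡ p) →
            sum (map multiplicity (map B (allFin q))) ≡ q ℕ.* p
          family B e = trans (sum-const multiplicity p (map B (allFin q)) λ w∈ → one (∈-map⁻ B w∈))
            (cong (ℕ._* p) (trans (List.length-map B (allFin q)) (length-allFin q)))
            where
            one : ∀ {w} → (∃ λ k → k ∈ allFin q × w ≡ B k) → multiplicity w ≡ p
            one (k , _ , refl) = e k

          length-indices : ∀ (f : Fin p → Fin p × Fin p) → length (map f (allFin p)) ≡ p
          length-indices f = trans (List.length-map f (allFin p)) (length-allFin p)

          sum-special : sum (map multiplicity special) ≡ p ℕ.* p ℕ.+ 3 ℕ.* (q ℕ.* p)
          sum-special = cong₂ ℕ._+_
            (trans (multiplicity≡ zero-occurrences)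
              (trans (length-cartesianProductWith _,_ (allFin p) (allFin p))
                (cong₂ ℕ._*_ (length-allFin p) (length-allFin p))))
            (trans (append startBlocks (endBlocks ++ alternatingBlocks))
              (cong₂ ℕ._+_ (family startBlock λ k → trans (multiplicity≡ (start-occurrences k))
                (length-indices startIndex))
              (trans (append endBlocks alternatingBlocks)
                (cong₂ ℕ._+_ (family endBlock λ k → trans (multiplicity≡ (end-occurrences k))
                  (length-indices endIndex))
                (trans (family alternatingBlock λ k →
                  trans (multiplicity≡ (alternating-occurrences k))
                    (length-indices alternatingIndex)) (sym (ℕ.+-identityʳ _)))))))
            where
            append : ∀ xs ys →
              sum (map multiplicity (xs ++ ys))
                ≡ sum (map multiplicity xs) ℕ.+ sum (map multiplicity ys)
            append xs ys = trans (cong sum (List.map-++ multiplicity xs ys))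
              (sum-++ (map multiplicity xs) _)

          length-special : length special ≡ suc (3 ℕ.* q)
          length-special =
            cong suc (trans (List.length-++ startBlocks) (cong₂ ℕ._+_ (family-length startBlock)
            (trans (List.length-++ endBlocks)
              (cong₂ ℕ._+_ (family-length endBlock)
                (trans (family-length alternatingBlock) (sym (ℕ.+-identityʳ q)))))))
            where
            family-length : ∀ (B : Fin q → Block m) → length (map B (allFin q)) ≡ q
            family-length B = trans (List.length-map B (allFin q)) (length-allFin q)

          total : sum (map (proj₁ ∘ parents) indices) ℕ.+ suc (3 ℕ.* q) ≡
                  p ℕ.* p ℕ.+ 3 ℕ.* (q ℕ.* p) ℕ.+ length (special ++ ordinaryBlocks)
          total = begin
            sum (map (proj₁ ∘ parents) indices) ℕ.+ suc (3 ℕ.* q)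
              ≡⟨ cong (λ s → s ℕ.+ suc (3 ℕ.* q)) (cong sum (List.map-cong length-pieces indices)) ⟨
            sum (map (length ∘ pieces) indices) ℕ.+ suc (3 ℕ.* q)
              ≡⟨ cong₂ ℕ._+_ (cover-count occursAt⇒accessible accessible-occurs special
                unique-special special-accessible separated) (sym length-special) ⟩
            sum (map multiplicity special) ℕ.+ length ordinaryBlocks ℕ.+ length special
              ≡⟨ cong (λ s → s ℕ.+ length ordinaryBlocks ℕ.+ length special) sum-special ⟩
            N ℕ.+ length ordinaryBlocks ℕ.+ length special
              ≡⟨ ℕ.+-assoc N _ _ ⟩
            N ℕ.+ (length ordinaryBlocks ℕ.+ length special)
              ≡⟨ cong (N ℕ.+_) (trans (List.length-++ special) (ℕ.+-comm (length special) _)) ⟨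
            N ℕ.+ length (special ++ ordinaryBlocks) ∎
            where
            open ≡-Reasoning
            N = p ℕ.* p ℕ.+ 3 ℕ.* (q ℕ.* p)

    -- The recurrence

    allBlocks : ∀ m → List (Block m)
    allBlocks zero    = [] ∷ []
    allBlocks (suc m) = cartesianProductWith _∷_ (allFin p) (allBlocks m)

    allBlocks-count : ∀ m → (∀ (w : Block m) → Acc w) → IsNumAccessible p onePlusX m (p ℕ.^ m)
    allBlocks-count m acc = allBlocks m , unique m , len m , λ w →
      mk⇔ (λ _ → acc w) (λ _ → complete w)
      where
      unique : ∀ m → Unique (allBlocks m)
      unique zero    = [] ∷ []
      unique (suc m) = Unique.cartesianProductWith⁺ _∷_ Vec.∷-injective (Unique.allFin⁺ p)
        (unique m)
      len : ∀ m → length (allBlocks m) ≡ p ℕ.^ m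
      len zero    = refl
      len (suc m) = trans (length-cartesianProductWith _∷_ (allFin p) (allBlocks m))
        (cong₂ ℕ._*_ (length-allFin p) (len m))
      complete : ∀ {m} (w : Block m) → w ∈ allBlocks m
      complete []      = here refl
      complete (c ∷ w) = ∈-cartesianProductWith⁺ _∷_ (∈-allFin c) (complete w)

    inverse : ∀ c → ¬ val c ≋ 0ℤ → ∃ λ e → val c * e ≋ 1ℤ
    inverse c c≉0
      with coprime-Bézout
        (prime⇒coprime isPrime {{ℕ.≢-nonZero λ c≡0 → c≉0 (≋-reflexive (cong +_ c≡0))}}
          (Fin.toℕ<n c))
    ... | Bézout.-+ x y eq = + y , linear₁ (+ x) (identity (+ x) (+ y) (val c) (+ p) bezout) p≋0
      where
      bezout : 1ℤ + + x * + p ≡ + y * val c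
      bezout = trans (cong (λ t → 1ℤ + t) (sym (ℤ.pos-* x p)))
        (trans (cong +_ eq) (ℤ.pos-* y (toℕ c)))
      lemma : ∀ x y c p → c * y - 1ℤ ≡ y * c - (1ℤ + x * p) + x * (p - 0ℤ)
      lemma = solve-∀
      identity : ∀ x y c p → 1ℤ + x * p ≡ y * c → c * y - 1ℤ ≡ x * (p - 0ℤ)
      identity x y c p e =
        trans (lemma x y c p) (trans (cong (λ t → t + x * (p - 0ℤ)) (ℤ.i≡j⇒i-j≡0 (sym e)))
          (ℤ.+-identityˡ _))
    ... | Bézout.+- x y eq = - + y , linear₁ (- + x) (identity (+ x) (+ y) (val c) (+ p) bezout) p≋0
      where
      bezout : 1ℤ + + y * val c ≡ + x * + p
      bezout = trans (cong (λ t → 1ℤ + t) (sym (ℤ.pos-* y (toℕ c))))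
        (trans (cong +_ eq) (ℤ.pos-* x p))
      lemma : ∀ x y c p → c * - y - 1ℤ ≡ (x * p - (1ℤ + y * c)) + - x * (p - 0ℤ)
      lemma = solve-∀
      identity : ∀ x y c p → 1ℤ + y * c ≡ x * p → c * - y - 1ℤ ≡ - x * (p - 0ℤ)
      identity x y c p e =
        trans (lemma x y c p) (trans (cong (λ t → t + - x * (p - 0ℤ)) (ℤ.i≡j⇒i-j≡0 (sym e)))
          (ℤ.+-identityˡ _))

    -- A pair c, d with c nonzero is c times the beginning 1, n of a row with n ≡ d/c; a pair 0, d
    -- is the end block of length 2; a single residue is a multiple of the entry of row 0.
    accessible-≤2 : ∀ {m} → m ℕ.≤ 2 → (w : Block m) → Acc w
    accessible-≤2 _ [] = window-accessible 0 0 0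
    accessible-≤2 _ (c ∷ []) =
      subst Acc (sym
        (≡block {f = f} (c ∷ []) λ { zero _ → ≋-reflexive (sym (ℤ.*-identityʳ (val c))) ; (suc y)
          (s<s ()) }))
      (scaled-window-accessible 0 0 1 (toℕ c))
      where
      f : ℕ → ℤ
      f y = val c * binom 0 y
    accessible-≤2 _ (c ∷ d ∷ []) with val c ≋? 0ℤ
    ... | yes c≋0 =
          occursAt⇒accessible
            (subst (OccursAt r (residue 0)) (sym (≡block {f = atEnd 1 (val d)} (c ∷ d ∷ [])
                      λ { zero _ → c≋0 ; (suc zero) _ → ≋-refl ; (suc (suc y)) (s<s (s<s ())) }))
                      (end-occursAt 1 d (linear₁ 1ℤ (identity (val r)) (val-red (- + 2)))))
      where
      r = red (- + 2)
      identity : ∀ r → (1ℤ + r) + 1ℤ - 0ℤ ≡ 1ℤ * (r - - + 2)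
      identity = solve-∀
    ... | no  c≉0 with e , ce≋1 ← inverse c c≉0 = subst Acc (sym (≡block {f = f} (c ∷ d ∷ [])
                      λ { zero _ → ≋-reflexive (sym (ℤ.*-identityʳ (val c))) ; (suc zero) _ →
                        ratio ; (suc (suc y)) (s<s (s<s ())) }))
                      (scaled-window-accessible n 0 2 (toℕ c))
      where
      n = toℕ (red (e * val d))
      f : ℕ → ℤ
      f y = val c * binom n y
      ratio : val d ≋ val c * binom n 1
      ratio = ≋-trans (linear₂ -1ℤ (- val c) (identity (val c) (val d) e (+ n))
        (*-congˡ (val d) ce≋1) (val-red (e * val d)))
        (≋-reflexive (cong (val c *_) (sym (binom-1 n))))
        where
        identity : ∀ c d e n → d - c * n ≡ -1ℤ * (d * (c * e) - d * 1ℤ) + - c * (n - e * d)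
        identity = solve-∀
    accessible-≤2 (s≤s (s≤s ())) (_ ∷ _ ∷ _ ∷ _)

    -- r + m < p + m ≤ (m - 1) p, using m ≥ 3 and p ≥ 3. For m = 2 a parent can again have length 2,
    -- so the recursion needs the lengths up to 2 as base cases.
    parentLength-< : ∀ {m} → 3 ℕ.≤ m → ∀ r j → parentLength m r j ℕ.< m
    parentLength-< {suc (suc (suc l))} (s≤s (s≤s (s≤s _))) r j =
      s≤s (ℕ.≤-trans (ℕ.m∸n≤m _ (skip r j))
      (ℕ.m<n*o⇒m/o<n (begin-strict
        toℕ r ℕ.+ (3 ℕ.+ l)           <⟨ ℕ.+-monoˡ-< (3 ℕ.+ l) (Fin.toℕ<n r) ⟩
        p ℕ.+ (3 ℕ.+ l)               ≤⟨ ℕ.+-monoʳ-≤ p (ℕ.+-mono-≤ 3≤p (ℕ.m≤m*n l p)) ⟩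
        p ℕ.+ (p ℕ.+ l ℕ.* p)         ∎)))
      where open ℕ.≤-Reasoning

    abstract
      -- The recursion stays opaque: `a-≤2` and `a-recurrence` recover its values from the
      -- uniqueness of the count.
      numAccessible : ∀ m → ∃ (IsNumAccessible p onePlusX m)
      numAccessible = <-rec _ step
        where
        step : ∀ m → (∀ {n} → n ℕ.< m → ∃ (IsNumAccessible p onePlusX n)) →
          ∃ (IsNumAccessible p onePlusX m)
        step zero _ = _ , allBlocks-count 0 (accessible-≤2 z≤n)
        step (suc zero) _ = _ , allBlocks-count 1 (accessible-≤2 (s≤s z≤n))
        step (suc (suc zero)) _ = _ , allBlocks-count 2 (accessible-≤2 (s≤s (s≤s z≤n)))
        step (suc (suc (suc l))) smaller =
          let c , isNum , _ = count (2 ℕ.+ l) (s≤s (s≤s z≤n)) (λ (r , j) → smaller (parentLength-< (s≤s (s≤s (s≤s z≤n))) r j))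
          in c , isNum

    a : ℕ → ℕ
    a m = proj₁ (numAccessible m)

    a-≤2 : ∀ {m} → m ℕ.≤ 2 → a m ≡ p ℕ.^ m
    a-≤2 {m} m≤2 = isNumAccessible-unique (proj₂ (numAccessible m))
      (allBlocks-count m (accessible-≤2 m≤2))

    a-recurrence : ∀ m → 3 ℕ.≤ m →
      sum (map (λ (r , j) → a (parentLength m r j)) indices) ℕ.+ suc (3 ℕ.* q)
        ≡ p ℕ.* p ℕ.+ 3 ℕ.* (q ℕ.* p) ℕ.+ a m
    a-recurrence (suc (suc (suc l))) (s≤s (s≤s (s≤s _))) =
      let c , isNum , total = count (2 ℕ.+ l) (s≤s (s≤s z≤n)) (λ (r , j) → numAccessible (parentLength (3 ℕ.+ l) r j))
      in trans total
        (cong (p ℕ.* p ℕ.+ 3 ℕ.* (q ℕ.* p) ℕ.+_)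
          (isNumAccessible-unique isNum (proj₂ (numAccessible (3 ℕ.+ l)))))

    -- Evaluation of the sum over all pairs for m = pn + k

    module _ (n k : ℕ) (k<p : k ℕ.< p) where

      private
        m = p ℕ.* n ℕ.+ k
        A = p ℕ.∸ k
        A+k≡p : A ℕ.+ k ≡ p
        A+k≡p = ℕ.m∸n+n≡m (ℕ.<⇒≤ k<p)

      quotient : ∀ r → (toℕ r ℕ.+ m) ℕ./ p ≡ threshold A n (suc n) (toℕ r)
      quotient r with ℕ.<-≤-connex (toℕ r) A
      ... | inj₁ r<A = trans (cong (ℕ._/ p) position)
            (trans (n/p n r+k<p) (sym (threshold-below n (suc n) r<A)))
        where
        r+k<p : toℕ r ℕ.+ k ℕ.< p
        r+k<p = subst (toℕ r ℕ.+ k ℕ.<_) A+k≡p (ℕ.+-monoˡ-< k r<A)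
        position : toℕ r ℕ.+ m ≡ p ℕ.* n ℕ.+ (toℕ r ℕ.+ k)
        position = x∙yz≈y∙xz (toℕ r) (p ℕ.* n) k
      ... | inj₂ A≤r = trans (cong (ℕ._/ p) position)
            (trans (n/p (suc n) s<p) (sym (threshold-above n (suc n) A≤r)))
        where
        s = toℕ r ℕ.∸ A
        s<p : s ℕ.< p
        s<p = ℕ.≤-<-trans (ℕ.m∸n≤m (toℕ r) A) (Fin.toℕ<n r)
        position : toℕ r ℕ.+ m ≡ p ℕ.* suc n ℕ.+ s
        position = begin
          toℕ r ℕ.+ (p ℕ.* n ℕ.+ k)             ≡⟨ x∙yz≈y∙xz (toℕ r) (p ℕ.* n) k ⟩
          p ℕ.* n ℕ.+ (toℕ r ℕ.+ k)             ≡⟨ cong (λ t → p ℕ.* n ℕ.+ (t ℕ.+ k))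
            (ℕ.m∸n+n≡m A≤r) ⟨
          p ℕ.* n ℕ.+ (s ℕ.+ A ℕ.+ k)           ≡⟨ cong (p ℕ.* n ℕ.+_)
            (trans (ℕ.+-assoc s A k) (trans (cong (s ℕ.+_) A+k≡p) (ℕ.+-comm s p))) ⟩
          p ℕ.* n ℕ.+ (p ℕ.+ s)                 ≡⟨ ℕ.+-assoc (p ℕ.* n) p s ⟨
          p ℕ.* n ℕ.+ p ℕ.+ s                   ≡⟨ cong (ℕ._+ s)
            (trans (ℕ.+-comm (p ℕ.* n) p) (sym (ℕ.*-suc p n))) ⟩
          p ℕ.* suc n ℕ.+ s                     ∎
          where open ≡-Reasoning

      parentLength≡ : ∀ r j → let t = threshold A n (suc n) (toℕ r) in
                      parentLength m r j ≡ threshold (suc (toℕ r)) t (suc t) (toℕ j)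
      parentLength≡ r j with skip-cases r j
      ... | inj₁ (r<j , skip≡0) = trans (cong₂ (λ t s → suc t ℕ.∸ s) (quotient r) skip≡0)
            (sym (threshold-above _ _ r<j))
      ... | inj₂ (j≤r , skip≡1) = trans (cong₂ (λ t s → suc t ℕ.∸ s) (quotient r) skip≡1)
            (sym (threshold-below _ _ (s≤s j≤r)))

      threshold-map : ∀ (f : ℕ → ℕ) t x y i → f (threshold t x y i) ≡ threshold t (f x) (f y) i
      threshold-map f zero    x y i       = refl
      threshold-map f (suc t) x y zero    = refl
      threshold-map f (suc t) x y (suc i) = threshold-map f t x y i

      -- For fixed r, let t be the quotient of r + m by p. The r + 1 values j ≤ r have parents of
      -- length t, and the other p - r - 1 have parents of length t + 1. A carry occurs when r + k
      -- reaches p, so t is n for r < p - k and n + 1 from there on.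
      sum-parents : sum (map (λ (r , j) → a (parentLength m r j)) indices) ≡
        ∑ A (λ i → suc i ℕ.* a n ℕ.+ (p ℕ.∸ suc i) ℕ.* a (suc n)) ℕ.+
        ∑ k (λ i → suc (A ℕ.+ i) ℕ.* a (suc n) ℕ.+ (p ℕ.∸ suc (A ℕ.+ i)) ℕ.* a (suc (suc n)))
      sum-parents = begin
        sum (map (λ (r , j) → a (parentLength m r j)) indices)
          ≡⟨ sum-cartesianProduct (λ (r , j) → a (parentLength m r j)) (allFin p) (allFin p) ⟩
        sum (map (λ r → sum (map (λ j → a (parentLength m r j)) (allFin p))) (allFin p))
          ≡⟨ sum-allFin _ rowSum inner ⟩
        ∑ p rowSum
          ≡⟨ cong (λ t → ∑ t rowSum) A+k≡p ⟨
        ∑ (A ℕ.+ k) rowSum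
          ≡⟨ ∑-split A k rowSum ⟩
        ∑ A rowSum ℕ.+ ∑ k (rowSum ∘ (A ℕ.+_))
          ≡⟨ cong₂ ℕ._+_
               (∑-cong A λ i i<A → cong (λ t → suc i ℕ.* a t ℕ.+ (p ℕ.∸ suc i) ℕ.* a (suc t))
                 (threshold-below n (suc n) i<A))
               (∑-cong k λ i _ →
                 cong (λ t → suc (A ℕ.+ i) ℕ.* a t ℕ.+ (p ℕ.∸ suc (A ℕ.+ i)) ℕ.* a (suc t))
                   (threshold-above n (suc n) (ℕ.m≤m+n A i))) ⟩
        _ ∎
        where
        open ≡-Reasoning
        rowSum : ℕ → ℕ
        rowSum i = suc i ℕ.* a (threshold A n (suc n) i) ℕ.+ (p ℕ.∸ suc i) ℕ.* a
          (suc (threshold A n (suc n) i))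
        inner : ∀ r → sum (map (λ j → a (parentLength m r j)) (allFin p)) ≡ rowSum (toℕ r)
        inner r = trans (sum-allFin _ (threshold (suc (toℕ r)) (a t) (a (suc t)))
            (λ j → trans (cong a (parentLength≡ r j))
              (threshold-map a (suc (toℕ r)) t (suc t) (toℕ j))))
          (∑-threshold (a t) (a (suc t)) (Fin.toℕ<n r))
          where t = threshold A n (suc n) (toℕ r)

      formula : 3 ℕ.≤ m →
        + 2 * + a m ≡ ((+ p - + k) * (+ p - + k + + 1)) * + a n
          + (+ 2 * + k * + p + + 2 * + k - + 2 * (+ k * + k) + + p * + p - + p) * + a (n ℕ.+ 1)
          + (+ k * + k - + k) * + a (n ℕ.+ 2)
          - + 2 * ((+ 2 * + p - + 1) * (+ 2 * + p - + 2))
      formula 3≤m = begin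
        + 2 * + a m
          ≡⟨ identity₁ (+ p) (+ a m) (+ Σ₁) (+ Σ₂) total ⟩
        + 2 * + Σ₁ + + 2 * + Σ₂ - + 2 * ((+ 2 * + p - + 1) * (+ 2 * + p - + 2))
          ≡⟨ cong (λ t → t - + 2 * ((+ 2 * + p - + 1) * (+ 2 * + p - + 2))) (cong₂ _+_
               (twice-∑-linear p (a n) (a (suc n)) A 0 (ℕ.m∸n≤m p k))
               (twice-∑-linear p (a (suc n)) (a (suc (suc n))) k A (ℕ.≤-reflexive A+k≡p))) ⟩
        (+ A * (+ 2 * 0ℤ + + A + 1ℤ) * + a n + + A * (+ 2 * + p - + 2 * 0ℤ - + A - 1ℤ) * + a
          (suc n)) +
        (+ k * (+ 2 * + A + + k + 1ℤ) * + a (suc n) + + k * (+ 2 * + p - + 2 * + A - + k - 1ℤ) * + a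
          (suc (suc n))) -
        + 2 * ((+ 2 * + p - + 1) * (+ 2 * + p - + 2))
          ≡⟨ cong (λ t →
            (t * (+ 2 * 0ℤ + t + 1ℤ) * + a n + t * (+ 2 * + p - + 2 * 0ℤ - t - 1ℤ) * + a (suc n)) +
               (+ k * (+ 2 * t + + k + 1ℤ) * + a (suc n) + + k * (+ 2 * + p - + 2 * t - + k - 1ℤ)
                 * + a (suc (suc n))) -
               + 2 * ((+ 2 * + p - + 1) * (+ 2 * + p - + 2))) (pos-∸ (ℕ.<⇒≤ k<p)) ⟩
        _ ≡⟨ identity₂ (+ p) (+ k) (+ a n) (+ a (suc n)) (+ a (suc (suc n))) ⟩
        ((+ p - + k) * (+ p - + k + + 1)) * + a n
          + (+ 2 * + k * + p + + 2 * + k - + 2 * (+ k * + k) + + p * + p - + p) * + a (suc n)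
          + (+ k * + k - + k) * + a (suc (suc n))
          - + 2 * ((+ 2 * + p - + 1) * (+ 2 * + p - + 2))
          ≡⟨ cong₂ (λ s t → ((+ p - + k) * (+ p - + k + + 1)) * + a n
               + (+ 2 * + k * + p + + 2 * + k - + 2 * (+ k * + k) + + p * + p - + p) * + a s
               + (+ k * + k - + k) * + a t
               - + 2 * ((+ 2 * + p - + 1) * (+ 2 * + p - + 2))) (ℕ.+-comm 1 n) (ℕ.+-comm 2 n) ⟩
        _ ∎
        where
        open ≡-Reasoning
        Σ₁ = ∑ A (λ i → suc i ℕ.* a n ℕ.+ (p ℕ.∸ suc i) ℕ.* a (suc n))
        Σ₂ = ∑ k (λ i → suc (A ℕ.+ i) ℕ.* a (suc n) ℕ.+ (p ℕ.∸ suc (A ℕ.+ i)) ℕ.* a (suc (suc n)))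
        total : (+ Σ₁ + + Σ₂) + (1ℤ + + 3 * (+ p - 1ℤ))
          ≡ + p * + p + + 3 * ((+ p - 1ℤ) * + p) + + a m
        total = begin
          (+ Σ₁ + + Σ₂) + (1ℤ + + 3 * (+ p - 1ℤ))
            ≡⟨ cong₂ (λ s t → + s + (1ℤ + t)) sum-parents (trans (ℤ.pos-* 3 q) (cong (+ 3 *_) q≡)) ⟨
          + (sum (map (λ (r , j) → a (parentLength m r j)) indices) ℕ.+ suc (3 ℕ.* q))
            ≡⟨ cong +_ (a-recurrence m 3≤m) ⟩
          + (p ℕ.* p) + + (3 ℕ.* (q ℕ.* p)) + + a m
            ≡⟨ cong₂ (λ s t → s + t + + a m) (ℤ.pos-* p p)
                 (trans (ℤ.pos-* 3 (q ℕ.* p))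
                   (cong (+ 3 *_) (trans (ℤ.pos-* q p) (cong (_* + p) q≡)))) ⟩
          + p * + p + + 3 * ((+ p - 1ℤ) * + p) + + a m ∎
          where
          q≡ : + q ≡ + p - 1ℤ
          q≡ = trans (cong (λ t → + (t ℕ.∸ 1)) 1+q≡p) (pos-∸ 0<p)
        -- The constant arises here as p² + 3(p - 1)p - (1 + 3(p - 1)) = (2p - 1)(2p - 2).
        identity₁ : ∀ p c s t → (s + t) + (1ℤ + + 3 * (p - 1ℤ)) ≡ p * p + + 3 * ((p - 1ℤ) * p) + c →
                    + 2 * c ≡ + 2 * s + + 2 * t - + 2 * ((+ 2 * p - + 1) * (+ 2 * p - + 2))
        identity₁ p c s t e =
          trans (lemma₁ p c)
            (trans (cong (λ u → + 2 * (u - (p * p + + 3 * ((p - 1ℤ) * p)))) (sym e)) (lemma₂ p s t))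
          where
          lemma₁ : ∀ p c →
            + 2 * c ≡ + 2 * (p * p + + 3 * ((p - 1ℤ) * p) + c - (p * p + + 3 * ((p - 1ℤ) * p)))
          lemma₁ = solve-∀
          lemma₂ : ∀ p s t →
            + 2 * ((s + t) + (1ℤ + + 3 * (p - 1ℤ)) - (p * p + + 3 * ((p - 1ℤ) * p))) ≡
                   + 2 * s + + 2 * t - + 2 * ((+ 2 * p - + 1) * (+ 2 * p - + 2))
          lemma₂ = solve-∀
        identity₂ : ∀ p k x y z →
          ((p - k) * (+ 2 * 0ℤ + (p - k) + 1ℤ) * x + (p - k) * (+ 2 * p - + 2 * 0ℤ - (p - k) - 1ℤ)
            * y) +
          (k * (+ 2 * (p - k) + k + 1ℤ) * y + k * (+ 2 * p - + 2 * (p - k) - k - 1ℤ) * z) -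
          + 2 * ((+ 2 * p - + 1) * (+ 2 * p - + 2)) ≡
          ((p - k) * (p - k + + 1)) * x + (+ 2 * k * p + + 2 * k - + 2 * (k * k) + p * p - p) * y
            + (k * k - k) * z
          - + 2 * ((+ 2 * p - + 1) * (+ 2 * p - + 2))
        identity₂ = solve-∀


open import Defs
open import Data.Nat using (ℕ; _+_; _*_; _^_; _≤_; _<_; NonZero)
open import Data.Nat.Primality using (Prime)
open import Data.Integer using (ℤ; +_) renaming (_+_ to _+ℤ_; _*_ to _*ℤ_; _-_ to _-ℤ_)
open import Data.Product using (Σ; _×_)
open import Relation.Binary.PropositionalEquality using (_≡_)

theorem2p3 : (p : ℕ) .{{_ : NonZero p}} → Prime p → 3 ≤ p →
    Σ (ℕ → ℕ) λ a →
    (∀ m → IsNumAccessible p onePlusX m (a m)) ×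
    a 0 ≡ 1 × a 1 ≡ p × a 2 ≡ p ^ 2 ×
    (∀ n k → k < p → 3 ≤ p * n + k →
    + 2 *ℤ + a (p * n + k)
    ≡ ((+ p -ℤ + k) *ℤ (+ p -ℤ + k +ℤ + 1)) *ℤ + a n
    +ℤ (+ 2 *ℤ + k *ℤ + p +ℤ + 2 *ℤ + k -ℤ + 2 *ℤ (+ k *ℤ + k)
    +ℤ + p *ℤ + p -ℤ + p) *ℤ + a (n + 1)
    +ℤ (+ k *ℤ + k -ℤ + k) *ℤ + a (n + 2)
    -ℤ + 2 *ℤ ((+ 2 *ℤ + p -ℤ + 1) *ℤ (+ 2 *ℤ + p -ℤ + 2)))
theorem2p3 p isPrime 3≤p =
  a , (λ m → proj₂ (numAccessible m)) , a-≤2 z≤n ,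
  trans (a-≤2 (s≤s z≤n)) (ℕ.*-identityʳ p) , a-≤2 (s≤s (s≤s z≤n)) , formula
  where open Pascal.PascalModulo p isPrime 3≤p
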